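{- Let $G$ be a bridgeless cubic graph containing a 2-factor having at most two cycles. If $G$ is not the Petersen graph, then there is a perfect matching $F$ of $G$ such that $G/\overline{F}$ admits a non-conflicting nowhere-zero $\mathbb{Z}_2\times\mathbb{Z}_2$-flow with respect to $\overline{F}$.
   Context: Graphs are finite, loopless, and may have parallel edges. For a perfect matching $F$ of a cubic graph $G$, $\overline{F}=G-F$ is the complementary 2-factor, and $G/\overline{F}$ is the pseudo-graph obtained by contracting each cycle of $\overline{F}$ to a vertex; its edges are the edges of $F$ (edges of $F$ with both ends on one cycle become loops). Write $\mathbb{Z}_2\times\mathbb{Z}_2=\{0,\alpha,\beta,\alpha+\beta\}$. A nowhere-zero $\mathbb{Z}_2\times\mathbb{Z}_2$-flow is an assignment $\theta$ of nonzero elements to the edges such that at every vertex the sum of values on incident edges is $0$ (loops counted twice). Such a flow of $G/\overline{F}$ is non-conflicting with respect to $\overline{F}$ if no edge $uv$ of $\overline{F}$ has $u$ incident to an edge of $F$ with value $\alpha$ and $v$ incident to an edge of $F$ with value $\beta$. -}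

module Defs where

open import Data.Nat using (ℕ; zero; suc; _+_)
open import Data.Bool using (Bool; true; false; if_then_else_; not; _xor_)
open import Data.Fin using (Fin; _≟_; #_)
open import Data.List using (List; []; _∷_; map; allFin)
open import Data.Nat.ListAction using (sum)
import Data.List
open import Data.Vec using (Vec; lookup) renaming ([] to []ᵥ; _∷_ to _∷ᵥ_)
open import Data.Product using (Σ; _×_; _,_; proj₁; proj₂; ∃; ∃-syntax)
open import Data.Sum using (_⊎_)
open import Relation.Nullary using (¬_; does)
open import Relation.Binary.PropositionalEquality using (_≡_; _≢_)
open import Function.Bundles using (_↔_; Inverse)

record Graph : Set where
  field
    n        : ℕ
    m        : ℕ
    ends     : Fin m → Fin n × Fin n
    loopless : ∀ e → proj₁ (ends e) ≢ proj₂ (ends e)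

open Graph public

EdgeSet : Graph → Set
EdgeSet G = Fin (m G) → Bool

allEdges : (G : Graph) → EdgeSet G
allEdges G _ = true

complement : (G : Graph) → EdgeSet G → EdgeSet G
complement G S e = not (S e)

without : (G : Graph) → Fin (m G) → EdgeSet G
without G e f = not (does (e ≟ f))

incidence : (G : Graph) → Fin (n G) → Fin (m G) → ℕ
incidence G v e =
  (if does (v ≟ proj₁ (ends G e)) then 1 else 0) +
  (if does (v ≟ proj₂ (ends G e)) then 1 else 0)

degree : (G : Graph) → EdgeSet G → Fin (n G) → ℕ
degree G S v = sum (map (λ e → if S e then incidence G v e else 0) (allFin (m G)))

Cubic : Graph → Set
Cubic G = ∀ v → degree G (allEdges G) v ≡ 3

PerfectMatching : (G : Graph) → EdgeSet G → Set
PerfectMatching G F = ∀ v → degree G F v ≡ 1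

TwoFactor : (G : Graph) → EdgeSet G → Set
TwoFactor G S = ∀ v → degree G S v ≡ 2

data Reach (G : Graph) (S : EdgeSet G) (u : Fin (n G)) : Fin (n G) → Set where
  here : Reach G S u u
  step : ∀ {w x} (e : Fin (m G)) → S e ≡ true →
         (ends G e ≡ (w , x) ⊎ ends G e ≡ (x , w)) →
         Reach G S u w → Reach G S u x

Bridgeless : Graph → Set
Bridgeless G = ∀ e → Reach G (without G e) (proj₁ (ends G e)) (proj₂ (ends G e))

-- the 2-factor S has at most two cycles (connected components):
-- the vertices can be split into two classes, each lying within one component
AtMostTwoCycles : (G : Graph) → EdgeSet G → Set
AtMostTwoCycles G S = Σ (Fin (n G) → Fin 2) λ c → ∀ u v → c u ≡ c v → Reach G S u v

-- The Petersen graph (outer 5-cycle, spokes, inner pentagram)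

petersenEndsV : Vec (Fin 10 × Fin 10) 15
petersenEndsV =
  (# 0 , # 1) ∷ᵥ (# 1 , # 2) ∷ᵥ (# 2 , # 3) ∷ᵥ (# 3 , # 4) ∷ᵥ (# 4 , # 0) ∷ᵥ
  (# 0 , # 5) ∷ᵥ (# 1 , # 6) ∷ᵥ (# 2 , # 7) ∷ᵥ (# 3 , # 8) ∷ᵥ (# 4 , # 9) ∷ᵥ
  (# 5 , # 7) ∷ᵥ (# 7 , # 9) ∷ᵥ (# 9 , # 6) ∷ᵥ (# 6 , # 8) ∷ᵥ (# 8 , # 5) ∷ᵥ []ᵥ

petersenEnds : Fin 15 → Fin 10 × Fin 10
petersenEnds = lookup petersenEndsV

swap : {A : Set} → A × A → A × A
swap (a , b) = (b , a)

IsPetersen : Graph → Set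
IsPetersen G =
  Σ (Fin (n G) ↔ Fin 10) λ φ → Σ (Fin (m G) ↔ Fin 15) λ ψ →
    ∀ e → let f = Inverse.to φ ; (u , v) = ends G e in
          petersenEnds (Inverse.to ψ e) ≡ (f u , f v) ⊎
          petersenEnds (Inverse.to ψ e) ≡ (f v , f u)

Z2² : Set
Z2² = Bool × Bool

𝟘 α β : Z2²
𝟘 = (false , false)
α = (true , false)
β = (false , true)

_⊕_ : Z2² → Z2² → Z2²
(a , b) ⊕ (c , d) = (a xor c , b xor d)

sumZ : List Z2² → Z2²
sumZ [] = 𝟘
sumZ (x ∷ xs) = x ⊕ sumZ xs

-- Contraction G / F̄.
-- A labelling c : Fin n → Fin k is a cycle-labelling of the 2-factor F̄ if
-- its labels are exactly the cycles (components) of F̄: it is surjective and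
-- c u ≡ c v iff u, v lie on the same cycle of F̄.  Then G/F̄ is the
-- pseudo-graph with vertex set Fin k and edge set F, the edge e ∈ F having
-- ends c u, c v where (u , v) = ends e (a loop when c u ≡ c v).

CycleLabelling : (G : Graph) → EdgeSet G → (k : ℕ) → (Fin (n G) → Fin k) → Set
CycleLabelling G F k c =
  (∀ i → ∃[ v ] c v ≡ i) ×
  (∀ u v → (c u ≡ c v → Reach G (complement G F) u v) × (Reach G (complement G F) u v → c u ≡ c v))

-- value contributed by edge e at contracted vertex i (loops counted twice)
atC : (G : Graph) → ∀ {k} → (Fin (n G) → Fin k) → Z2² → Fin k → Fin (m G) → List Z2²
atC G c x i e =
  (if does (i ≟ c (proj₁ (ends G e))) then x else 𝟘) ∷
  (if does (i ≟ c (proj₂ (ends G e))) then x else 𝟘) ∷ []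

NZFlowContraction : (G : Graph) → (F : EdgeSet G) → ∀ {k} → (Fin (n G) → Fin k) →
                    (Fin (m G) → Z2²) → Set
NZFlowContraction G F c θ =
  (∀ e → F e ≡ true → θ e ≢ 𝟘) ×
  (∀ i → sumZ (concatMapF (λ e → if F e then atC G c (θ e) i e else [])) ≡ 𝟘)
  where
  concatMapF : (Fin (m G) → List Z2²) → List Z2²
  concatMapF f = Data.List.concatMap f (allFin (m G))

Incident : (G : Graph) → Fin (n G) → Fin (m G) → Set
Incident G v e = v ≡ proj₁ (ends G e) ⊎ v ≡ proj₂ (ends G e)

NonConflicting : (G : Graph) → EdgeSet G → (Fin (m G) → Z2²) → Set
NonConflicting G F θ =
  ∀ e → F e ≡ false → ∀ f g → F f ≡ true → F g ≡ true →
  let (u , v) = ends G e in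
  ¬ (Incident G u f × Incident G v g × θ f ≡ α × θ g ≡ β) ×
  ¬ (Incident G v f × Incident G u g × θ f ≡ α × θ g ≡ β)

{-# OPTIONS --safe #-}

-- Even edge sets of G form a vector space over ℤ₂, and a pair (Z₁ , Z₂) of them is a ℤ₂ × ℤ₂-flow
-- of G; restricted to a perfect matching F it is a flow of G/F̄.  So it suffices to find F and two
-- even sets that cover F and do not conflict.  Sets of edges with prescribed boundary inside the
-- 2-factor S are obtained by adding up paths (T-joins), so circuits need never be enumerated.
--
-- If the circuits of S are even (or S is a Hamiltonian circuit), take F = G − S and the constant α.
-- Otherwise S has two odd circuits, joined by an odd number of crossing edges.
--  * If no edge of S links the crossing edges e and f, then F = G − S works with the value α on e,
--    β on f and α + β elsewhere.
--  * If any two crossing edges are linked and there are at least five of them, then the two circuits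
--    two-colour the pairs of crossing edges without a monochromatic claw; this forces a pentagon and
--    its complementary pentagram, and G is the Petersen graph.
--  * If there are exactly three crossing edges e₁, e₂, e₃, remove both ends of e₁ from S and match
--    the rest of each circuit by alternate edges.  F consists of these edges and e₁.  The even sets
--    are S and an even set D through e₁ and e₂: only e₁ has value β, so it is enough that the
--    matching edges next to the ends of e₁ lie in D.  This can be achieved, adding a chord to D if
--    necessary, unless the two neighbours on S of an end of e₁ are joined by a chord; then this chord is put
--    into F instead, with the value α + β.
module Submission where

open import Defs
open import Algebra.Bundles using (CommutativeMonoid; CommutativeRing)
open import Axiom.UniquenessOfIdentityProofs using (module Decidable⇒UIP)
open import Data.Bool using (Bool; true; false; if_then_else_; not; _∧_; _xor_)
import Data.Bool.Properties as Boolₚ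
open import Data.Bool.Solver using (module xor-∧-Solver)
open import Data.Empty using (⊥; ⊥-elim)
open import Data.Fin as Fin using (Fin; zero; suc; splitAt; #_; _≟_; punchIn; punchOut)
open import Data.Fin.Patterns using (0F; 1F; 2F; 3F; 4F)
open import Data.Fin.Properties
  using (any?; all?; pigeonhole; join-splitAt; punchInᵢ≢i; punchOut-punchIn; punchOut-injective; punchOut-cong)
open import Data.List using (List; []; _∷_; _++_; map; concatMap; tabulate; allFin)
open import Data.List.Membership.Propositional.Properties using (∈-allFin)
open import Data.List.Relation.Unary.All as All using (All; []; _∷_)
open import Data.Nat using (ℕ; zero; suc; _+_; s≤s)
open import Data.Nat.ListAction using () renaming (sum to sumˡ)
import Data.Nat.Properties as ℕₚ
open import Data.Product using (Σ; _×_; _,_; proj₁; proj₂; ∃-syntax)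
import Data.Product.Properties as ×
open import Data.Sum using (_⊎_; [_,_]′; inj₁; inj₂)
open import Data.Vec using (Vec; lookup; []; _∷_)
open import Data.Vec.Relation.Unary.All as VecAll using ([]; _∷_)
open import Data.Vec.Relation.Unary.All.Properties using (lookup⁺)
open import Data.Vec.Relation.Unary.AllPairs using ([]; _∷_)
open import Data.Vec.Relation.Unary.Unique.Propositional using (Unique)
open import Data.Vec.Relation.Unary.Unique.Propositional.Properties using (lookup-injective)
open import Function using (_∘_; id; case_of_)
open import Function.Bundles using (mk↔ₛ′)
open import Relation.Binary.PropositionalEquality
  using (_≡_; _≢_; refl; sym; trans; cong; cong₂; subst; module ≡-Reasoning)
open import Relation.Nullary using (¬_; Dec; does; yes; no; contradiction)
open import Relation.Nullary.Decidable
  using (decidable-stable; True; toWitness; dec-true; dec-false; _→-dec_; _×-dec_; _⊎-dec_; ¬?)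

-- Finite sums with small support

module SparseSum {c} (M : CommutativeMonoid c c) where
  open CommutativeMonoid M renaming (_∙_ to _⊹_; trans to ≈-trans; sym to ≈-sym)
  open import Algebra.Properties.CommutativeMonoid.Sum M

  sum-indicator : ∀ {k} (a : Fin k) x → sum (λ e → if does (e ≟ a) then x else ε) ≈ x
  sum-indicator {suc k} zero x = ≈-trans (∙-congˡ (sum-replicate-zero k)) (identityʳ x)
  sum-indicator (suc a) x = ≈-trans (identityˡ _) (sum-indicator a x)

  sum-three : ∀ {k} (h : Fin k → Carrier) {p q r} → p ≢ q → p ≢ r → q ≢ r →
              (∀ e → e ≢ p → e ≢ q → e ≢ r → h e ≈ ε) → sum h ≈ h p ⊹ (h q ⊹ h r)
  sum-three {k} h {p} {q} {r} p≢q p≢r q≢r vanish =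
    ≈-trans (sum-cong-≋ split)
    (≈-trans (∑-distrib-+ (at p) (λ e → at q e ⊹ at r e))
    (∙-cong (sum-indicator p (h p))
    (≈-trans (∑-distrib-+ (at q) (at r)) (∙-cong (sum-indicator q (h q)) (sum-indicator r (h r))))))
    where
    at : Fin k → Fin k → Carrier
    at a e = if does (e ≟ a) then h a else ε
    split : ∀ e → h e ≈ at p e ⊹ (at q e ⊹ at r e)
    split e with e ≟ p | e ≟ q | e ≟ r
    ... | yes refl | yes e≡q  | _        = contradiction e≡q p≢q
    ... | yes refl | no _     | yes e≡r  = contradiction e≡r p≢r
    ... | yes refl | no _     | no _     = ≈-sym (≈-trans (∙-congˡ (identityˡ ε)) (identityʳ _))
    ... | no _     | yes refl | yes e≡r  = contradiction e≡r q≢r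
    ... | no _     | yes refl | no _     = ≈-sym (≈-trans (identityˡ _) (identityʳ _))
    ... | no _     | no _     | yes refl = ≈-sym (≈-trans (identityˡ _) (identityˡ _))
    ... | no ≢p    | no ≢q    | no ≢r    =
      ≈-trans (vanish e ≢p ≢q ≢r) (≈-sym (≈-trans (identityˡ _) (identityˡ _)))

open import Algebra.Properties.Semiring.Sum
  (CommutativeRing.semiring Boolₚ.xor-∧-commutativeRing)
  using (sum-cong-≗; ∑-distrib-+; ∑-comm; *-distribˡ-sum; sum-replicate-zero)
  renaming (sum to ⨁)
open import Algebra.Properties.CommutativeMonoid.Sum ℕₚ.+-0-commutativeMonoid
  using () renaming (sum to ∑; sum-cong-≗ to ∑-cong; ∑-distrib-+ to ∑-distrib)

open SparseSum (CommutativeRing.+-commutativeMonoid Boolₚ.xor-∧-commutativeRing)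
  renaming (sum-indicator to ⨁-indicator; sum-three to ⨁-three)
open SparseSum ℕₚ.+-0-commutativeMonoid
  renaming (sum-indicator to ∑-indicator; sum-three to ∑-three)

xor-cases : ∀ p {q} → p xor q ≡ true → p ≡ true ⊎ q ≡ true
xor-cases true  _  = inj₁ refl
xor-cases false eq = inj₂ eq

xor-false⇒≡ : ∀ {p q} → p xor q ≡ false → p ≡ q
xor-false⇒≡ {true}  {true}  _ = refl
xor-false⇒≡ {false} {false} _ = refl

⨁-false : ∀ {k} {f : Fin k → Bool} → (∀ i → f i ≡ false) → ⨁ f ≡ false
⨁-false {k} f≡ = trans (sum-cong-≗ f≡) (sum-replicate-zero k)

⨁-at : ∀ {k} (f : Fin k → Bool) a → ⨁ (λ i → f i ∧ does (i ≟ a)) ≡ f a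
⨁-at f a = trans (sum-cong-≗ pointwise) (⨁-indicator a (f a))
  where
  pointwise : ∀ i → f i ∧ does (i ≟ a) ≡ (if does (i ≟ a) then f a else false)
  pointwise i with i ≟ a
  ... | yes refl = Boolₚ.∧-identityʳ _
  ... | no _     = Boolₚ.∧-zeroʳ _

⨁-at-sym : ∀ {k} (f : Fin k → Bool) a → ⨁ (λ i → f i ∧ does (a ≟ i)) ≡ f a
⨁-at-sym f a = trans (sum-cong-≗ (λ i → cong (f i ∧_) (flip i))) (⨁-at f a)
  where
  flip : ∀ i → does (a ≟ i) ≡ does (i ≟ a)
  flip i with i ≟ a
  ... | yes refl = dec-true (a ≟ a) refl
  ... | no i≢a   = dec-false (a ≟ i) (i≢a ∘ sym)

⨁-single : ∀ {k} (a : Fin k) → ⨁ (λ i → does (i ≟ a)) ≡ true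
⨁-single a = ⨁-at (λ _ → true) a

⨁-true⇒∃ : ∀ {k} (f : Fin k → Bool) → ⨁ f ≡ true → ∃[ i ] f i ≡ true
⨁-true⇒∃ f odd with any? (λ i → f i Boolₚ.≟ true)
... | yes found = found
... | no none with () ← trans (sym odd) (⨁-false (λ i → Boolₚ.¬-not (none ∘ (i ,_))))

∑≡0⇒≡0 : ∀ {k} (f : Fin k → ℕ) → ∑ f ≡ 0 → ∀ i → f i ≡ 0
∑≡0⇒≡0 f ∑≡0 zero    = ℕₚ.m+n≡0⇒m≡0 (f zero) ∑≡0
∑≡0⇒≡0 f ∑≡0 (suc i) = ∑≡0⇒≡0 (f ∘ suc) (ℕₚ.m+n≡0⇒n≡0 (f zero) ∑≡0) i

∑≡suc⇒∃ : ∀ {k l} (f : Fin k → ℕ) → ∑ f ≡ suc l → ∃[ i ] f i ≢ 0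
∑≡suc⇒∃ {suc k} f ∑≡ with f zero in f₀
... | suc _ = zero , λ f₀≡0 → ℕₚ.1+n≢0 (trans (sym f₀) f₀≡0)
... | zero with i , fᵢ≢0 ← ∑≡suc⇒∃ (f ∘ suc) ∑≡ = suc i , fᵢ≢0

erase : ∀ {k} → Fin k → (Fin k → ℕ) → Fin k → ℕ
erase a f i = if does (i ≟ a) then 0 else f i

∑-erase : ∀ {k} (a : Fin k) (f : Fin k → ℕ) → ∑ f ≡ f a + ∑ (erase a f)
∑-erase a f = trans (∑-cong split)
                (trans (∑-distrib (λ i → if does (i ≟ a) then f a else 0) (erase a f))
                  (cong (_+ ∑ (erase a f)) (∑-indicator a (f a))))
  where
  split : ∀ i → f i ≡ (if does (i ≟ a) then f a else 0) + erase a f i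
  split i with i ≟ a
  ... | yes refl = sym (ℕₚ.+-identityʳ _)
  ... | no _     = refl

erase-≢ : ∀ {k} (a : Fin k) (f : Fin k → ℕ) {i} → erase a f i ≢ 0 → i ≢ a × f i ≢ 0
erase-≢ a f {i} ≢0 with i ≟ a
... | yes _  = contradiction refl ≢0
... | no i≢a = i≢a , ≢0

≢-erase : ∀ {k} (a : Fin k) (f : Fin k → ℕ) {i} → i ≢ a → f i ≢ 0 → erase a f i ≢ 0
≢-erase a f {i} i≢a ≢0 with i ≟ a
... | yes i≡a = contradiction i≡a i≢a
... | no _    = ≢0

∑≡1-support : ∀ {k} (f : Fin k → ℕ) → ∑ f ≡ 1 →
              ∃[ a ] (f a ≢ 0 × ∀ i → f i ≢ 0 → i ≡ a)
∑≡1-support f ∑≡1 with a , fₐ≢0 ← ∑≡suc⇒∃ f ∑≡1 = a , fₐ≢0 , unique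
  where
  rest : ∑ (erase a f) ≡ 0
  rest with f a | ∑-erase a f
  ... | zero  | _  = contradiction refl fₐ≢0
  ... | suc k | eq = ℕₚ.m+n≡0⇒n≡0 k (ℕₚ.suc-injective (trans (sym eq) ∑≡1))
  unique : ∀ i → f i ≢ 0 → i ≡ a
  unique i fᵢ≢0 with i ≟ a
  ... | yes i≡a = i≡a
  ... | no i≢a  = contradiction (∑≡0⇒≡0 _ rest i) (≢-erase a f i≢a fᵢ≢0)

-- The hypothesis `small` excludes a single index that carries the whole value 2; hence erasing one
-- index of the support leaves a sum of 1.
∑≡2-support : ∀ {k} (f : Fin k → ℕ) → (∀ i → f i ≢ 0 → f i ≡ 1) → ∑ f ≡ 2 →
              ∃[ a ] ∃[ b ] (a ≢ b × f a ≢ 0 × f b ≢ 0 × ∀ i → f i ≢ 0 → i ≡ a ⊎ i ≡ b)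
∑≡2-support f small ∑≡2
  with a , fₐ≢0 ← ∑≡suc⇒∃ f ∑≡2
  with b , ≢0 , unique ← ∑≡1-support (erase a f)
         (ℕₚ.suc-injective (trans (sym (trans (∑-erase a f) (cong (_+ ∑ (erase a f)) (small a fₐ≢0)))) ∑≡2))
  with b≢a , f_b≢0 ← erase-≢ a f ≢0
  = a , b , b≢a ∘ sym , fₐ≢0 , f_b≢0 , cover
  where
  cover : ∀ i → f i ≢ 0 → i ≡ a ⊎ i ≡ b
  cover i fᵢ≢0 with i ≟ a
  ... | yes i≡a = inj₁ i≡a
  ... | no i≢a  = inj₂ (unique i (≢-erase a f i≢a fᵢ≢0))

sumZ-++ : ∀ xs ys → sumZ (xs ++ ys) ≡ sumZ xs ⊕ sumZ ys
sumZ-++ []             ys = refl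
sumZ-++ ((a , b) ∷ xs) ys rewrite sumZ-++ xs ys =
  cong₂ _,_ (sym (Boolₚ.xor-assoc a _ _)) (sym (Boolₚ.xor-assoc b _ _))

sumZ-concatMap : ∀ {A : Set} {k} (g : A → List Z2²) (h : Fin k → A) →
                 sumZ (concatMap g (tabulate h)) ≡
                 (⨁ (λ i → proj₁ (sumZ (g (h i)))) , ⨁ (λ i → proj₂ (sumZ (g (h i)))))
sumZ-concatMap {k = zero}  g h = refl
sumZ-concatMap {k = suc k} g h =
  trans (sumZ-++ (g (h zero)) _) (cong (sumZ (g (h zero)) ⊕_) (sumZ-concatMap g (h ∘ suc)))

-- Edge sets as vectors over ℤ₂ and their boundaries

module EdgeSpace (G : Graph) where

  V E : Set
  V = Fin (n G)
  E = Fin (m G)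

  tl hd : E → V
  tl e = proj₁ (ends G e)
  hd e = proj₂ (ends G e)

  -- The ends of an edge differ, so at most one of the two tests succeeds and the parity is
  -- incidence itself. This form makes `∂` a linear map over ℤ₂.
  inc : V → E → Bool
  inc v e = does (v ≟ tl e) xor does (v ≟ hd e)

  ∂ : EdgeSet G → V → Bool
  ∂ J v = ⨁ (λ e → inc v e ∧ J e)

  infixr 6 _△_
  _△_ : EdgeSet G → EdgeSet G → EdgeSet G
  (J △ K) e = J e xor K e

  ∅ : EdgeSet G
  ∅ _ = false

  ⁅_⁆ : E → EdgeSet G
  ⁅ a ⁆ e = does (e ≟ a)

  ⁅⁆-self : ∀ a → ⁅ a ⁆ a ≡ true
  ⁅⁆-self a = dec-true (a ≟ a) refl

  ⁅⁆-other : ∀ {a e} → e ≢ a → ⁅ a ⁆ e ≡ false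
  ⁅⁆-other {a} {e} = dec-false (e ≟ a)

  ⁅⁆-true : ∀ {a e} → ⁅ a ⁆ e ≡ true → e ≡ a
  ⁅⁆-true {a} {e} eq with yes e≡a ← e ≟ a = e≡a

  ∂-∅ : ∀ v → ∂ ∅ v ≡ false
  ∂-∅ v = ⨁-false (λ e → Boolₚ.∧-zeroʳ (inc v e))

  ∂-△ : ∀ J K v → ∂ (J △ K) v ≡ ∂ J v xor ∂ K v
  ∂-△ J K v = trans (sum-cong-≗ (λ e → Boolₚ.∧-distribˡ-xor (inc v e) (J e) (K e)))
                    (∑-distrib-+ (λ e → inc v e ∧ J e) (λ e → inc v e ∧ K e))

  ∂-⁅⁆ : ∀ a v → ∂ ⁅ a ⁆ v ≡ inc v a
  ∂-⁅⁆ a v = ⨁-at (inc v) a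

  ∂-⨁ : ∀ {k} (T : Fin k → Bool) (P : Fin k → EdgeSet G) w →
        ∂ (λ e → ⨁ (λ i → T i ∧ P i e)) w ≡ ⨁ (λ i → T i ∧ ∂ (P i) w)
  ∂-⨁ T P w = begin
    ⨁ (λ e → inc w e ∧ ⨁ (λ i → T i ∧ P i e))
      ≡⟨ sum-cong-≗ (λ e → *-distribˡ-sum (inc w e) (λ i → T i ∧ P i e)) ⟩
    ⨁ (λ e → ⨁ (λ i → inc w e ∧ (T i ∧ P i e)))
      ≡⟨ ∑-comm (λ e i → inc w e ∧ (T i ∧ P i e)) ⟩
    ⨁ (λ i → ⨁ (λ e → inc w e ∧ (T i ∧ P i e)))
      ≡⟨ sum-cong-≗ (λ i → sum-cong-≗ (λ e → ∧-exchange (inc w e) (T i) (P i e))) ⟩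
    ⨁ (λ i → ⨁ (λ e → T i ∧ (inc w e ∧ P i e)))
      ≡⟨ sum-cong-≗ (λ i → *-distribˡ-sum (T i) (λ e → inc w e ∧ P i e)) ⟨
    ⨁ (λ i → T i ∧ ∂ (P i) w) ∎
    where
    open ≡-Reasoning
    ∧-exchange : ∀ a b c → a ∧ (b ∧ c) ≡ b ∧ (a ∧ c)
    ∧-exchange = solve 3 (λ a b c → a :* (b :* c) := b :* (a :* c)) refl
      where open xor-∧-Solver

  -- Both sides count the pairs of an edge of `J` and one of its ends, weighted by `χ`. If `χ` is
  -- the indicator of a class, an edge with both ends inside cancels, so the right side is the
  -- parity of the edges of `J` that leave the class.
  handshake : ∀ (χ : V → Bool) J →
              ⨁ (λ v → χ v ∧ ∂ J v) ≡ ⨁ (λ e → J e ∧ (χ (tl e) xor χ (hd e)))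
  handshake χ J = begin
    ⨁ (λ v → χ v ∧ ⨁ (λ e → inc v e ∧ J e))
      ≡⟨ sum-cong-≗ (λ v → *-distribˡ-sum (χ v) (λ e → inc v e ∧ J e)) ⟩
    ⨁ (λ v → ⨁ (λ e → χ v ∧ (inc v e ∧ J e)))
      ≡⟨ ∑-comm (λ v e → χ v ∧ (inc v e ∧ J e)) ⟩
    ⨁ (λ e → ⨁ (λ v → χ v ∧ (inc v e ∧ J e)))
      ≡⟨ sum-cong-≗ (λ e → sum-cong-≗ (λ v → rearrange (χ v) (does (v ≟ tl e)) (does (v ≟ hd e)) (J e))) ⟩
    ⨁ (λ e → ⨁ (λ v → J e ∧ (χ v ∧ does (v ≟ tl e) xor χ v ∧ does (v ≟ hd e))))
      ≡⟨ sum-cong-≗ (λ e → *-distribˡ-sum (J e) (λ v → χ v ∧ does (v ≟ tl e) xor χ v ∧ does (v ≟ hd e))) ⟨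
    ⨁ (λ e → J e ∧ ⨁ (λ v → χ v ∧ does (v ≟ tl e) xor χ v ∧ does (v ≟ hd e)))
      ≡⟨ sum-cong-≗ (λ e → cong (J e ∧_) (∑-distrib-+ (λ v → χ v ∧ does (v ≟ tl e)) (λ v → χ v ∧ does (v ≟ hd e)))) ⟩
    ⨁ (λ e → J e ∧ (⨁ (λ v → χ v ∧ does (v ≟ tl e)) xor ⨁ (λ v → χ v ∧ does (v ≟ hd e))))
      ≡⟨ sum-cong-≗ (λ e → cong (J e ∧_) (cong₂ _xor_ (⨁-at χ (tl e)) (⨁-at χ (hd e)))) ⟩
    ⨁ (λ e → J e ∧ (χ (tl e) xor χ (hd e))) ∎
    where
    open ≡-Reasoning
    rearrange : ∀ x a b j → x ∧ ((a xor b) ∧ j) ≡ j ∧ (x ∧ a xor x ∧ b)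
    rearrange = solve 4 (λ x a b j → x :* ((a :+ b) :* j) := j :* (x :* a :+ x :* b)) refl
      where open xor-∧-Solver

  handshake-total : ∀ J → ⨁ (∂ J) ≡ false
  handshake-total J = trans (handshake (λ _ → true) J) (⨁-false (λ e → Boolₚ.∧-zeroʳ (J e)))

  Joins : E → V → V → Set
  Joins e u v = ends G e ≡ (u , v) ⊎ ends G e ≡ (v , u)

  joins-sym : ∀ {e u v} → Joins e u v → Joins e v u
  joins-sym (inj₁ eq) = inj₂ eq
  joins-sym (inj₂ eq) = inj₁ eq

  joins-≢ : ∀ {e u v} → Joins e u v → u ≢ v
  joins-≢ {e} (inj₁ eq) refl = loopless G e (trans (cong proj₁ eq) (sym (cong proj₂ eq)))
  joins-≢ {e} (inj₂ eq) refl = loopless G e (trans (cong proj₁ eq) (sym (cong proj₂ eq)))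

  joins-incidentˡ : ∀ {e u v} → Joins e u v → Incident G u e
  joins-incidentˡ (inj₁ eq) = inj₁ (sym (cong proj₁ eq))
  joins-incidentˡ (inj₂ eq) = inj₂ (sym (cong proj₂ eq))

  joins-incidentʳ : ∀ {e u v} → Joins e u v → Incident G v e
  joins-incidentʳ = joins-incidentˡ ∘ joins-sym

  joins-ends : ∀ e → Joins e (tl e) (hd e)
  joins-ends e = inj₁ refl

  incident-joins : ∀ {e v} → Incident G v e → ∃[ w ] Joins e v w
  incident-joins {e} (inj₁ refl) = hd e , inj₁ refl
  incident-joins {e} (inj₂ refl) = tl e , inj₂ refl

  joins-cover : ∀ {e u v x} → Joins e u v → Incident G x e → x ≡ u ⊎ x ≡ v
  joins-cover (inj₁ eq) (inj₁ refl) = inj₁ (cong proj₁ eq)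
  joins-cover (inj₁ eq) (inj₂ refl) = inj₂ (cong proj₂ eq)
  joins-cover (inj₂ eq) (inj₁ refl) = inj₂ (cong proj₁ eq)
  joins-cover (inj₂ eq) (inj₂ refl) = inj₁ (cong proj₂ eq)

  joins-inc : ∀ {e u v} → Joins e u v → ∀ w → inc w e ≡ does (w ≟ u) xor does (w ≟ v)
  joins-inc (inj₁ eq) w rewrite eq = refl
  joins-inc {u = u} (inj₂ eq) w rewrite eq = Boolₚ.xor-comm _ (does (w ≟ u))

  incident? : ∀ v e → Dec (Incident G v e)
  incident? v e = (v ≟ tl e) ⊎-dec (v ≟ hd e)

  inc-true : ∀ {v e} → Incident G v e → inc v e ≡ true
  inc-true {v} {e} v∈e with v ≟ tl e | v ≟ hd e | v∈e
  ... | yes v≡t | yes v≡h | _        = contradiction (trans (sym v≡t) v≡h) (loopless G e)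
  ... | yes _   | no _    | _        = refl
  ... | no _    | yes _   | _        = refl
  ... | no v≢t  | no v≢h  | inj₁ v≡t = contradiction v≡t v≢t
  ... | no v≢t  | no v≢h  | inj₂ v≡h = contradiction v≡h v≢h

  inc-false : ∀ {v e} → ¬ Incident G v e → inc v e ≡ false
  inc-false {v} {e} v∉e
    rewrite dec-false (v ≟ tl e) (v∉e ∘ inj₁) | dec-false (v ≟ hd e) (v∉e ∘ inj₂) = refl

  incidence-inc : ∀ v e → incidence G v e ≡ (if inc v e then 1 else 0)
  incidence-inc v e with v ≟ tl e | v ≟ hd e
  ... | yes v≡t | yes v≡h = contradiction (trans (sym v≡t) v≡h) (loopless G e)
  ... | yes _   | no _    = refl
  ... | no _    | yes _   = refl
  ... | no _    | no _    = refl

  infix 4 _⊆_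
  _⊆_ : EdgeSet G → EdgeSet G → Set
  J ⊆ K = ∀ e → J e ≡ true → K e ≡ true

  module _ {S : EdgeSet G} where

    reach-trans : ∀ {u v w} → Reach G S u v → Reach G S v w → Reach G S u w
    reach-trans p here            = p
    reach-trans p (step e s eq q) = step e s eq (reach-trans p q)

    reach-edge : ∀ {e u v} → S e ≡ true → Joins e u v → Reach G S u v
    reach-edge {e} s eq = step e s eq here

    reach-sym : ∀ {u v} → Reach G S u v → Reach G S v u
    reach-sym here            = here
    reach-sym (step e s eq p) = reach-trans (reach-edge s (joins-sym eq)) (reach-sym p)

    reach-closed : ∀ {ℓ} (P : V → Set ℓ) → (∀ {e u v} → S e ≡ true → Joins e u v → P u → P v) →
                   ∀ {u v} → Reach G S u v → P u → P v
    reach-closed P closed here            = id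
    reach-closed P closed (step e s eq p) = closed s eq ∘ reach-closed P closed p

    -- The boundaries of the edges of a walk telescope. An edge that is walked twice cancels in the
    -- sum, so walks need not be reduced to paths.
    path-boundary : ∀ {u v} → Reach G S u v →
                    ∃[ J ] (J ⊆ S × ∀ w → ∂ J w ≡ does (w ≟ u) xor does (w ≟ v))
    path-boundary {u} here = ∅ , (λ _ ()) , λ w → trans (∂-∅ w) (sym (Boolₚ.xor-same (does (w ≟ u))))
    path-boundary {u} {v} (step {w} e s eq p) with J , J⊆S , ∂J ← path-boundary p =
      J △ ⁅ e ⁆ , sub , λ z → begin
        ∂ (J △ ⁅ e ⁆) z                    ≡⟨ ∂-△ J ⁅ e ⁆ z ⟩
        ∂ J z xor ∂ ⁅ e ⁆ z                ≡⟨ cong₂ _xor_ (∂J z) (trans (∂-⁅⁆ e z) (joins-inc eq z)) ⟩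
        (does (z ≟ u) xor does (z ≟ w)) xor (does (z ≟ w) xor does (z ≟ v))
                                           ≡⟨ cancel (does (z ≟ u)) (does (z ≟ w)) (does (z ≟ v)) ⟩
        does (z ≟ u) xor does (z ≟ v)      ∎
      where
      open ≡-Reasoning
      sub : (J △ ⁅ e ⁆) ⊆ S
      sub f Jf with f ≟ e
      ... | yes refl = s
      ... | no _     = J⊆S f (trans (sym (Boolₚ.xor-identityʳ (J f))) Jf)
      cancel : ∀ a b c → (a xor b) xor (b xor c) ≡ a xor c
      cancel = solve 3 (λ a b c → (a :+ b) :+ (b :+ c) := a :+ c) refl
        where open xor-∧-Solver

    -- Existence of T-joins. Each vertex of `T` is joined by a walk to a fixed root `r` in `T`. The
    -- sum of these walks has boundary `T`, except that `r` is counted once more for each vertex of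
    -- `T`, which is an even number of times.
    join : ∀ T → (∀ u v → T u ≡ true → T v ≡ true → Reach G S u v) → ⨁ T ≡ false →
           ∃[ J ] (J ⊆ S × ∀ v → ∂ J v ≡ T v)
    join T connected even with any? (λ v → T v Boolₚ.≟ true)
    ... | no none = ∅ , (λ _ ()) , λ v → trans (∂-∅ v) (sym (Boolₚ.¬-not (none ∘ (v ,_))))
    ... | yes (r , Tr) = J , J⊆S , ∂J
      where
      path : ∀ v → ∃[ P ] (P ⊆ S × (T v ≡ true → ∀ w → ∂ P w ≡ does (w ≟ v) xor does (w ≟ r)))
      path v with T v in Tv
      -- A vertex outside `T` need not reach the root; the empty set is a placeholder that the
      -- factor `T v` in `J` removes.
      ... | false = ∅ , (λ _ ()) , λ ()
      ... | true with P , P⊆S , ∂P ← path-boundary (connected v r Tv Tr) = P , P⊆S , λ _ → ∂P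

      P : V → EdgeSet G
      P v = proj₁ (path v)

      J : EdgeSet G
      J e = ⨁ (λ v → T v ∧ P v e)

      J⊆S : J ⊆ S
      J⊆S e Je with v , TP ← ⨁-true⇒∃ (λ v → T v ∧ P v e) Je =
        proj₁ (proj₂ (path v)) e (Boolₚ.∧-conicalʳ (T v) _ TP)

      ∂J : ∀ w → ∂ J w ≡ T w
      ∂J w = begin
        ∂ J w
          ≡⟨ ∂-⨁ T P w ⟩
        ⨁ (λ v → T v ∧ ∂ (P v) w)
          ≡⟨ sum-cong-≗ pointwise ⟩
        ⨁ (λ v → T v ∧ does (w ≟ v) xor does (w ≟ r) ∧ T v)
          ≡⟨ ∑-distrib-+ (λ v → T v ∧ does (w ≟ v)) (λ v → does (w ≟ r) ∧ T v) ⟩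
        ⨁ (λ v → T v ∧ does (w ≟ v)) xor ⨁ (λ v → does (w ≟ r) ∧ T v)
          ≡⟨ cong₂ _xor_ (⨁-at-sym T w) (sym (*-distribˡ-sum (does (w ≟ r)) T)) ⟩
        T w xor (does (w ≟ r) ∧ ⨁ T)
          ≡⟨ cong (λ z → T w xor (does (w ≟ r) ∧ z)) even ⟩
        T w xor (does (w ≟ r) ∧ false)
          ≡⟨ cong (T w xor_) (Boolₚ.∧-zeroʳ (does (w ≟ r))) ⟩
        T w xor false
          ≡⟨ Boolₚ.xor-identityʳ (T w) ⟩
        T w ∎
        where
        open ≡-Reasoning
        pointwise : ∀ v → T v ∧ ∂ (P v) w ≡ T v ∧ does (w ≟ v) xor does (w ≟ r) ∧ T v
        pointwise v = guarded (T v) (does (w ≟ r)) (λ Tv → proj₂ (proj₂ (path v)) Tv w)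
          where
          guarded : ∀ t {a b} c → (t ≡ true → a ≡ b xor c) → t ∧ a ≡ t ∧ b xor c ∧ t
          guarded false         c _  = sym (Boolₚ.∧-zeroʳ c)
          guarded true  {_} {b} c eq = trans (eq refl) (cong (b xor_) (sym (Boolₚ.∧-identityʳ c)))

  -- Components of the 2-factor and flows of the contracted graph

  Components : (S : EdgeSet G) (es : List E) → Set
  Components S es = Σ ℕ λ k → Σ (V → Fin k) λ c →
    (∀ i → ∃[ v ] c v ≡ i) ×
    (∀ u v → c u ≡ c v → Reach G S u v) ×
    All (λ e → S e ≡ true → c (tl e) ≡ c (hd e)) es

  -- The edges are processed one after another as in union-find, starting from distinct labels: an
  -- edge of `S` between two labels merges them. Equal labels always mean connected vertices, and
  -- once all edges of `G` have been processed the converse holds too.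
  components : ∀ S es → Components S es
  components S [] = n G , id , (λ i → i , refl) , (λ { u .u refl → here }) , []
  components S (e ∷ es) with components S es
  ... | k , c , surj , sound , done with S e in Se | c (tl e) ≟ c (hd e)
  ... | false | _ = k , c , surj , sound , (λ eq → contradiction (trans (sym eq) Se) λ ()) ∷ done
  ... | true | yes c≡ = k , c , surj , sound , (λ _ → c≡) ∷ done
  ... | true | no c≢ = merge k c surj sound done c≢
    where
    merge : ∀ k (c : V → Fin k) → (∀ i → ∃[ v ] c v ≡ i) → (∀ u v → c u ≡ c v → Reach G S u v) →
            All (λ f → S f ≡ true → c (tl f) ≡ c (hd f)) es → c (tl e) ≢ c (hd e) → Components S (e ∷ es)
    merge zero c _ _ _ _ with () ← c (tl e)
    merge (suc k) c surj sound done c≢ =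
      k , ρ ∘ c
      , (λ i → let v , cv = surj (punchIn b i) in v , trans (cong ρ cv) (ρ-punchIn i))
      , (λ u v → sound′ u v ∘ ρ-injective (c u) (c v))
      , (λ _ → ρ-glues) ∷ All.map (λ eq s → cong ρ (eq s)) done
      where
      a b : Fin (suc k)
      a = c (tl e)
      b = c (hd e)

      -- The label `b` is deleted from the range, and its vertices receive the label of `a`.
      ρ : Fin (suc k) → Fin k
      ρ x with b ≟ x
      ... | yes _  = punchOut (c≢ ∘ sym)
      ... | no b≢x = punchOut b≢x

      ρ-punchIn : ∀ i → ρ (punchIn b i) ≡ i
      ρ-punchIn i with b ≟ punchIn b i
      ... | yes eq = contradiction (sym eq) (punchInᵢ≢i b i)
      ... | no _   = punchOut-punchIn b

      ρ-glues : ρ a ≡ ρ b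
      ρ-glues with b ≟ a | b ≟ b
      ... | yes eq | _      = contradiction (sym eq) c≢
      ... | no _   | yes _  = punchOut-cong b refl
      ... | no _   | no b≢b = contradiction refl b≢b

      ρ-injective : ∀ x y → ρ x ≡ ρ y → x ≡ y ⊎ (x ≡ b × y ≡ a) ⊎ (x ≡ a × y ≡ b)
      ρ-injective x y eq with b ≟ x | b ≟ y
      ... | yes refl | yes refl = inj₁ refl
      ... | yes refl | no b≢y   = inj₂ (inj₁ (refl , sym (punchOut-injective (c≢ ∘ sym) b≢y eq)))
      ... | no b≢x   | yes refl = inj₂ (inj₂ (punchOut-injective b≢x (c≢ ∘ sym) eq , refl))
      ... | no b≢x   | no b≢y   = inj₁ (punchOut-injective b≢x b≢y eq)

      across : Reach G S (tl e) (hd e)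
      across = reach-edge Se (joins-ends e)

      sound′ : ∀ u v → c u ≡ c v ⊎ (c u ≡ b × c v ≡ a) ⊎ (c u ≡ a × c v ≡ b) → Reach G S u v
      sound′ u v (inj₁ eq) = sound u v eq
      sound′ u v (inj₂ (inj₁ (cu , cv))) =
        reach-trans (sound u (hd e) cu) (reach-trans (reach-sym across) (sound (tl e) v (sym cv)))
      sound′ u v (inj₂ (inj₂ (cu , cv))) =
        reach-trans (sound u (tl e) cu) (reach-trans across (sound (hd e) v (sym cv)))

  Solution : Set
  Solution = ∃[ F ] (PerfectMatching G F ×
    Σ ℕ λ k → Σ (V → Fin k) λ c → CycleLabelling G F k c ×
    ∃[ θ ] (NZFlowContraction G F c θ × NonConflicting G F θ))

  -- An even edge set of G, read on the edges of F only, is even at every vertex of G/F̄.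
  solution : ∀ F Z₁ Z₂ → PerfectMatching G F →
             (∀ v → ∂ Z₁ v ≡ false) → (∀ v → ∂ Z₂ v ≡ false) →
             (∀ e → F e ≡ true → (Z₁ e , Z₂ e) ≢ 𝟘) →
             NonConflicting G F (λ e → Z₁ e , Z₂ e) → Solution
  solution F Z₁ Z₂ pm ∂Z₁ ∂Z₂ nonzero nonconflicting
    with k , c , surj , sound , complete ← components (complement G F) (allFin (m G)) =
    F , pm , k , c , (surj , λ u v → sound u v , same-label) , θ , (nonzero , flow) , nonconflicting
    where
    θ : E → Z2²
    θ e = Z₁ e , Z₂ e

    edge-label : ∀ e → complement G F e ≡ true → c (tl e) ≡ c (hd e)
    edge-label e = All.lookup complete (∈-allFin e)

    same-label : ∀ {u v} → Reach G (complement G F) u v → c u ≡ c v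
    same-label here = refl
    same-label (step e s (inj₁ refl) p) = trans (same-label p) (edge-label e s)
    same-label (step e s (inj₂ refl) p) = trans (same-label p) (sym (edge-label e s))

    module _ (i : Fin k) where
      χ : V → Bool
      χ v = does (i ≟ c v)

      local : E → Z2²
      local e = sumZ (if F e then atC G c (θ e) i e else [])

      local-value : ∀ e → local e ≡ (Z₁ e ∧ (χ (tl e) xor χ (hd e)) , Z₂ e ∧ (χ (tl e) xor χ (hd e)))
      local-value e with F e in Fe
      ... | true = cases (χ (tl e)) (χ (hd e)) (Z₁ e) (Z₂ e)
        where
        cases : ∀ a b x y → (if a then (x , y) else 𝟘) ⊕ ((if b then (x , y) else 𝟘) ⊕ 𝟘) ≡
                            (x ∧ (a xor b) , y ∧ (a xor b))
        cases true  true  true  true  = refl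
        cases true  true  true  false = refl
        cases true  true  false true  = refl
        cases true  true  false false = refl
        cases true  false true  true  = refl
        cases true  false true  false = refl
        cases true  false false true  = refl
        cases true  false false false = refl
        cases false true  true  true  = refl
        cases false true  true  false = refl
        cases false true  false true  = refl
        cases false true  false false = refl
        cases false false true  true  = refl
        cases false false true  false = refl
        cases false false false true  = refl
        cases false false false false = refl
      -- Nothing is contributed on the left. On the right the two tests cancel, since an edge
      -- outside `F` has both ends under one label.
      ... | false
        rewrite edge-label e (cong not Fe) | Boolₚ.xor-same (χ (hd e))
              | Boolₚ.∧-zeroʳ (Z₁ e) | Boolₚ.∧-zeroʳ (Z₂ e) = refl

      even-at : ∀ Z → (∀ v → ∂ Z v ≡ false) → ⨁ (λ e → Z e ∧ (χ (tl e) xor χ (hd e))) ≡ false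
      even-at Z ∂Z = trans (sym (handshake χ Z))
        (⨁-false (λ v → trans (cong (χ v ∧_) (∂Z v)) (Boolₚ.∧-zeroʳ (χ v))))

    flow : ∀ i → sumZ (concatMap (λ e → if F e then atC G c (θ e) i e else []) (allFin (m G))) ≡ 𝟘
    flow i = trans (sumZ-concatMap (λ e → if F e then atC G c (θ e) i e else []) id)
      (cong₂ _,_
        (trans (sum-cong-≗ (λ e → cong proj₁ (local-value i e))) (even-at i Z₁ ∂Z₁))
        (trans (sum-cong-≗ (λ e → cong proj₂ (local-value i e))) (even-at i Z₂ ∂Z₂)))

-- Degrees and the three edges at a vertex

sum-tabulate : ∀ {A : Set} {k} (f : A → ℕ) (g : Fin k → A) → sumˡ (map f (tabulate g)) ≡ ∑ (f ∘ g)
sum-tabulate {k = zero}  f g = refl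
sum-tabulate {k = suc k} f g = cong (f (g zero) +_) (sum-tabulate f (g ∘ suc))

module CubicTwoFactor (G : Graph) (cubic : Cubic G) (S : EdgeSet G) (twoFactor : TwoFactor G S) where
  open EdgeSpace G

  term : EdgeSet G → V → E → ℕ
  term J v e = if J e then incidence G v e else 0

  degree-∑ : ∀ J v → degree G J v ≡ ∑ (term J v)
  degree-∑ J v = sum-tabulate (term J v) id

  term-nonzero : ∀ J v e → term J v e ≢ 0 → J e ≡ true × Incident G v e
  term-nonzero J v e ≢0 with J e | incident? v e
  ... | true  | yes v∈e = refl , v∈e
  ... | true  | no v∉e rewrite incidence-inc v e | inc-false v∉e = contradiction refl ≢0
  ... | false | _      = contradiction refl ≢0

  term-one : ∀ J {v} e → J e ≡ true → Incident G v e → term J v e ≡ 1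
  term-one J {v} e Je v∈e rewrite Je | incidence-inc v e | inc-true v∈e = refl

  term-positive : ∀ J v e → J e ≡ true → Incident G v e → term J v e ≢ 0
  term-positive J v e Je v∈e ≡0 with () ← trans (sym (term-one J e Je v∈e)) ≡0

  complement-degree : ∀ v → ∑ (term (complement G S) v) ≡ 1
  complement-degree v = ℕₚ.+-cancelˡ-≡ 2 _ _ (begin
      2 + ∑ (term (complement G S) v)
        ≡⟨ cong (_+ ∑ (term (complement G S) v)) (trans (sym (twoFactor v)) (degree-∑ S v)) ⟩
      ∑ (term S v) + ∑ (term (complement G S) v)
        ≡⟨ ∑-distrib (term S v) (term (complement G S) v) ⟨
      ∑ (λ e → term S v e + term (complement G S) v e)
        ≡⟨ ∑-cong split ⟨
      ∑ (term (allEdges G) v)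
        ≡⟨ degree-∑ (allEdges G) v ⟨
      degree G (allEdges G) v
        ≡⟨ cubic v ⟩
      3 ∎)
    where
    open ≡-Reasoning
    split : ∀ e → term (allEdges G) v e ≡ term S v e + term (complement G S) v e
    split e with S e
    ... | true  = sym (ℕₚ.+-identityʳ _)
    ... | false = refl

  record Star (v : V) : Set where
    field
      left right spoke : E
      left≢right       : left ≢ right
      left∈S           : S left ≡ true
      right∈S          : S right ≡ true
      spoke∉S          : S spoke ≡ false
      left-incident    : Incident G v left
      right-incident   : Incident G v right
      spoke-incident   : Incident G v spoke
      S-edge           : ∀ {e} → S e ≡ true → Incident G v e → e ≡ left ⊎ e ≡ right
      spoke-unique     : ∀ {e} → S e ≡ false → Incident G v e → e ≡ spoke

  abstract
    star : ∀ v → Star v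
    star v
      with a , b , a≢b , a≢0 , b≢0 , coverS ←
             ∑≡2-support (term S v)
               (λ e ≢0 → let s , v∈e = term-nonzero S v e ≢0 in term-one S e s v∈e)
               (trans (sym (degree-∑ S v)) (twoFactor v))
      with f , f≢0 , coverF ← ∑≡1-support (term (complement G S) v) (complement-degree v)
      = record
        { left = a ; right = b ; spoke = f ; left≢right = a≢b
        ; left∈S = proj₁ (term-nonzero S v a a≢0)
        ; right∈S = proj₁ (term-nonzero S v b b≢0)
        ; spoke∉S = trans (sym (Boolₚ.not-involutive (S f))) (cong not (proj₁ (term-nonzero (complement G S) v f f≢0)))
        ; left-incident = proj₂ (term-nonzero S v a a≢0)
        ; right-incident = proj₂ (term-nonzero S v b b≢0)
        ; spoke-incident = proj₂ (term-nonzero (complement G S) v f f≢0)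
        ; S-edge = λ {e} s v∈e → coverS e (term-positive S v e s v∈e)
        ; spoke-unique = λ {e} s v∈e → coverF e (term-positive (complement G S) v e (cong not s) v∈e)
        }

  spoke : V → E
  spoke v = Star.spoke (star v)

  S≢¬S : ∀ {e f} → S e ≡ true → S f ≡ false → e ≢ f
  S≢¬S s ¬s refl with () ← trans (sym s) ¬s

  -- Pigeonhole: `p`, `q`, `r` and `e` occupy the three places at `v`, so two of them coincide, and
  -- `e` must be one of the two.
  three-cover : ∀ {v p q r} → p ≢ q → p ≢ r → q ≢ r →
                Incident G v p → Incident G v q → Incident G v r →
                ∀ {e} → Incident G v e → e ≡ p ⊎ e ≡ q ⊎ e ≡ r
  three-cover {v} {p} {q} {r} p≢q p≢r q≢r v∈p v∈q v∈r {e} v∈e = coincidence repeated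
    where
    open Star (star v) hiding (spoke)

    slot : Fin 3 → E
    slot 0F = left
    slot 1F = right
    slot 2F = spoke v

    index : ∀ {e} → Incident G v e → ∃[ i ] e ≡ slot i
    index {e} v∈e with S e in Se
    ... | false = 2F , spoke-unique Se v∈e
    ... | true with S-edge Se v∈e
    ...   | inj₁ eq = 0F , eq
    ...   | inj₂ eq = 1F , eq

    edge : Fin 4 → Σ E (Incident G v)
    edge 0F = p , v∈p
    edge 1F = q , v∈q
    edge 2F = r , v∈r
    edge 3F = e , v∈e

    repeated : ∃[ i ] ∃[ j ] (i Fin.< j × proj₁ (edge i) ≡ proj₁ (edge j))
    repeated with i , j , i<j , same ← pigeonhole (ℕₚ.n<1+n 3) (λ i → proj₁ (index (proj₂ (edge i)))) =
      i , j , i<j ,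
      trans (proj₂ (index (proj₂ (edge i)))) (trans (cong slot same) (sym (proj₂ (index (proj₂ (edge j))))))

    coincidence : ∃[ i ] ∃[ j ] (i Fin.< j × proj₁ (edge i) ≡ proj₁ (edge j)) → e ≡ p ⊎ e ≡ q ⊎ e ≡ r
    coincidence (0F , 1F , _ , eq) = contradiction eq p≢q
    coincidence (0F , 2F , _ , eq) = contradiction eq p≢r
    coincidence (0F , 3F , _ , eq) = inj₁ (sym eq)
    coincidence (1F , 2F , _ , eq) = contradiction eq q≢r
    coincidence (1F , 3F , _ , eq) = inj₂ (inj₁ (sym eq))
    coincidence (2F , 3F , _ , eq) = inj₂ (inj₂ (sym eq))
    coincidence (0F , 0F , () , _)
    coincidence (1F , 0F , () , _)
    coincidence (1F , 1F , s≤s () , _)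
    coincidence (2F , 0F , () , _)
    coincidence (2F , 1F , s≤s () , _)
    coincidence (2F , 2F , s≤s (s≤s ()) , _)
    coincidence (3F , 0F , () , _)
    coincidence (3F , 1F , s≤s () , _)
    coincidence (3F , 2F , s≤s (s≤s ()) , _)
    coincidence (3F , 3F , s≤s (s≤s (s≤s ())) , _)

  ∂-three : ∀ J {v p q r} → p ≢ q → p ≢ r → q ≢ r →
            Incident G v p → Incident G v q → Incident G v r →
            ∂ J v ≡ J p xor (J q xor J r)
  ∂-three J {v} {p} {q} {r} p≢q p≢r q≢r v∈p v∈q v∈r =
    trans (⨁-three (λ e → inc v e ∧ J e) p≢q p≢r q≢r vanish)
          (cong₂ _xor_ (at v∈p) (cong₂ _xor_ (at v∈q) (at v∈r)))
    where
    at : ∀ {e} → Incident G v e → inc v e ∧ J e ≡ J e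
    at v∈e rewrite inc-true v∈e = refl
    vanish : ∀ e → e ≢ p → e ≢ q → e ≢ r → inc v e ∧ J e ≡ false
    vanish e ≢p ≢q ≢r = cong (_∧ J e) (inc-false λ v∈e →
      case three-cover p≢q p≢r q≢r v∈p v∈q v∈r v∈e of λ where
        (inj₁ eq)        → ≢p eq
        (inj₂ (inj₁ eq)) → ≢q eq
        (inj₂ (inj₂ eq)) → ≢r eq)

  ∂-star : ∀ J v → let open Star (star v) hiding (spoke) in
           ∂ J v ≡ J left xor (J right xor J (spoke v))
  ∂-star J v = ∂-three J left≢right (S≢¬S left∈S spoke∉S) (S≢¬S right∈S spoke∉S)
                 left-incident right-incident spoke-incident
    where open Star (star v) hiding (spoke)

  ∂S : ∀ v → ∂ S v ≡ false
  ∂S v = trans (∂-star S v) (cong₂ _xor_ left∈S (cong₂ _xor_ right∈S spoke∉S))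
    where open Star (star v) hiding (spoke)

  -- The spoke is the only edge at `v` outside `S`, so no other edge can contribute.
  ∂-spokes : ∀ {J} → (∀ e → J e ≡ true → S e ≡ false) → ∀ v → ∂ J v ≡ J (spoke v)
  ∂-spokes {J} J⊆¬S v = trans (∂-star J v)
    (cong₂ _xor_ (outside (Star.left∈S (star v)))
                 (cong (_xor J (spoke v)) (outside (Star.right∈S (star v)))))
    where
    outside : ∀ {e} → S e ≡ true → J e ≡ false
    outside {e} s = Boolₚ.¬-not λ Je → contradiction (trans (sym s) (J⊆¬S e Je)) λ ()

  -- An odd degree in a cubic graph is 1 or 3, and the missing edge at each vertex excludes 3.
  -- Perfect matchings can thus be built by parity arguments alone.
  perfect : ∀ {F} → (∀ v → ∂ F v ≡ true) → (∀ v → ∃[ e ] (Incident G v e × F e ≡ false)) →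
            PerfectMatching G F
  perfect {F} odd gap v = trans (degree-∑ F v) (trans total (exactly-one parity gap′))
    where
    open Star (star v) hiding (spoke)

    count : Bool → ℕ
    count b = if b then 1 else 0

    parity : F left xor (F right xor F (spoke v)) ≡ true
    parity = trans (sym (∂-star F v)) (odd v)

    cover : ∀ {e} → Incident G v e → e ≡ left ⊎ e ≡ right ⊎ e ≡ spoke v
    cover = three-cover left≢right (S≢¬S left∈S spoke∉S) (S≢¬S right∈S spoke∉S)
              left-incident right-incident spoke-incident

    gap′ : F left ≡ false ⊎ F right ≡ false ⊎ F (spoke v) ≡ false
    gap′ = let e , v∈e , ¬Fe = gap v in at ¬Fe (cover v∈e)
      where
      at : ∀ {e} → F e ≡ false → e ≡ left ⊎ e ≡ right ⊎ e ≡ spoke v →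
           F left ≡ false ⊎ F right ≡ false ⊎ F (spoke v) ≡ false
      at ¬Fe (inj₁ refl)        = inj₁ ¬Fe
      at ¬Fe (inj₂ (inj₁ refl)) = inj₂ (inj₁ ¬Fe)
      at ¬Fe (inj₂ (inj₂ refl)) = inj₂ (inj₂ ¬Fe)

    exactly-one : ∀ {a b c} → a xor (b xor c) ≡ true → a ≡ false ⊎ b ≡ false ⊎ c ≡ false →
                  count a + (count b + count c) ≡ 1
    exactly-one {true}  {false} {false} _ _ = refl
    exactly-one {false} {true}  {false} _ _ = refl
    exactly-one {false} {false} {true}  _ _ = refl
    exactly-one {true}  {true}  {true}  _ (inj₁ ())
    exactly-one {true}  {true}  {true}  _ (inj₂ (inj₁ ()))
    exactly-one {true}  {true}  {true}  _ (inj₂ (inj₂ ()))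

    value : ∀ {e} → Incident G v e → term F v e ≡ count (F e)
    value {e} v∈e with F e
    ... | false = refl
    ... | true rewrite incidence-inc v e | inc-true v∈e = refl

    vanish : ∀ e → e ≢ left → e ≢ right → e ≢ spoke v → term F v e ≡ 0
    vanish e ≢l ≢r ≢s = decidable-stable (term F v e ℕₚ.≟ 0) λ ≢0 →
      case cover (proj₂ (term-nonzero F v e ≢0)) of λ where
        (inj₁ eq)        → ≢l eq
        (inj₂ (inj₁ eq)) → ≢r eq
        (inj₂ (inj₂ eq)) → ≢s eq

    total : ∑ (term F v) ≡ count (F left) + (count (F right) + count (F (spoke v)))
    total = trans
      (∑-three (term F v) left≢right (S≢¬S left∈S spoke∉S) (S≢¬S right∈S spoke∉S) vanish)
      (cong₂ _+_ (value left-incident) (cong₂ _+_ (value right-incident) (value spoke-incident)))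

-- One odd circuit of the 2-factor

module Side (G : Graph) (cubic : Cubic G) (S : EdgeSet G) (twoFactor : TwoFactor G S)
            (χ : Fin (n G) → Bool)
            (connected : ∀ u v → χ u ≡ true → χ v ≡ true → Reach G S u v)
            (monochromatic : ∀ e → S e ≡ true → χ (proj₁ (ends G e)) ≡ χ (proj₂ (ends G e)))
            (odd : ⨁ χ ≡ true) where
  open EdgeSpace G
  open CubicTwoFactor G cubic S twoFactor

  crossing : E → Bool
  crossing e = χ (tl e) xor χ (hd e)

  crossing∉S : ∀ {e} → crossing e ≡ true → S e ≡ false
  crossing∉S {e} cross = Boolₚ.¬-not λ s →
    contradiction (trans (sym cross) (trans (cong (_xor χ (hd e)) (monochromatic e s)) (Boolₚ.xor-same (χ (hd e))))) λ ()

  Within : EdgeSet G → Set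
  Within J = ∀ e → J e ≡ true → χ (tl e) ≡ true × χ (hd e) ≡ true

  within-△ : ∀ {J K} → Within J → Within K → Within (J △ K)
  within-△ {J} {K} J-in K-in e JKe with J e in Je
  ... | true  = J-in e Je
  ... | false = K-in e JKe

  within-incident : ∀ {J e v} → Within J → J e ≡ true → Incident G v e → χ v ≡ true
  within-incident J-in Je (inj₁ refl) = proj₁ (J-in _ Je)
  within-incident J-in Je (inj₂ refl) = proj₂ (J-in _ Je)

  crossing-∉ : ∀ {J e} → Within J → crossing e ≡ true → J e ≡ false
  crossing-∉ {J} {e} J-in cross = Boolₚ.¬-not λ Je →
    let t , h = J-in e Je in contradiction (trans (sym cross) (cong₂ _xor_ t h)) λ ()

  ∂-outside : ∀ {J} → Within J → ∀ {v} → χ v ≡ false → ∂ J v ≡ false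
  ∂-outside {J} J-in {v} ¬χv = ⨁-false λ e → absent e
    where
    absent : ∀ e → inc v e ∧ J e ≡ false
    absent e with J e in Je
    ... | false = Boolₚ.∧-zeroʳ (inc v e)
    ... | true  = trans (Boolₚ.∧-identityʳ _) (inc-false λ v∈e →
                    contradiction (trans (sym (within-incident J-in Je v∈e)) ¬χv) λ ())

  joins-χ : ∀ {e u v} → S e ≡ true → Joins e u v → χ u ≡ true → χ v ≡ true
  joins-χ {e} s (inj₁ refl) χu = trans (sym (monochromatic e s)) χu
  joins-χ {e} s (inj₂ refl) χu = trans (monochromatic e s) χu

  joins-within : ∀ {e u v} → Joins e u v → χ u ≡ true → χ v ≡ true → χ (tl e) ≡ true × χ (hd e) ≡ true
  joins-within (inj₁ refl) χu χv = χu , χv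
  joins-within (inj₂ refl) χu χv = χv , χu

  restrict : EdgeSet G → EdgeSet G
  restrict J e = χ (tl e) ∧ J e

  restrict-⊆ : ∀ J → restrict J ⊆ J
  restrict-⊆ J e with χ (tl e)
  ... | true = id

  restrict-within : ∀ {J} → J ⊆ S → Within (restrict J)
  restrict-within {J} J⊆S e rJe with χ (tl e) in χt
  ... | true = refl , trans (sym (monochromatic e (J⊆S e rJe))) χt

  restrict-true : ∀ J {e} → χ (tl e) ≡ true → J e ≡ true → restrict J e ≡ true
  restrict-true J χt Je = cong₂ _∧_ χt Je

  ∂-restrict : ∀ {J} → J ⊆ S → ∀ v → ∂ (restrict J) v ≡ χ v ∧ ∂ J v
  ∂-restrict {J} J⊆S v =
    trans (sum-cong-≗ pointwise) (sym (*-distribˡ-sum (χ v) (λ e → inc v e ∧ J e)))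
    where
    pointwise : ∀ e → inc v e ∧ (χ (tl e) ∧ J e) ≡ χ v ∧ (inc v e ∧ J e)
    pointwise e with J e in Je | incident? v e
    ... | false | _ rewrite Boolₚ.∧-zeroʳ (χ (tl e)) | Boolₚ.∧-zeroʳ (inc v e) = sym (Boolₚ.∧-zeroʳ (χ v))
    ... | true | no v∉e rewrite inc-false v∉e = sym (Boolₚ.∧-zeroʳ (χ v))
    ... | true | yes (inj₁ refl) rewrite inc-true {e = e} (inj₁ refl) = refl
    ... | true | yes (inj₂ refl)
      rewrite inc-true {e = e} (inj₂ refl) | monochromatic e (J⊆S e Je) = refl

  -- A T-join on a single circuit has only one alternative, its complement in that circuit.
  -- Prescribing it at the edge `s` therefore determines it.
  Join : (V → Bool) → E → Bool → Set
  Join T s b = ∃[ J ] (J ⊆ S × Within J × (∀ v → ∂ J v ≡ T v) × J s ≡ b)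

  -- A join may be complemented along the circuit carrying s.
  join-at : ∀ T → (∀ v → T v ≡ true → χ v ≡ true) → ⨁ T ≡ false →
            ∀ s → S s ≡ true → χ (tl s) ≡ true → ∀ b →
            Join T s b
  join-at T T⊆χ even s s∈S χs b
    with J₀ , J₀⊆S , ∂J₀ ← join T (λ u v Tu Tv → connected u v (T⊆χ u Tu) (T⊆χ v Tv)) even
    with restrict J₀ s Boolₚ.≟ b
  ... | yes eq = restrict J₀ , (λ e → J₀⊆S e ∘ restrict-⊆ J₀ e) , restrict-within J₀⊆S , ∂J , eq
    where
    ∂J : ∀ v → ∂ (restrict J₀) v ≡ T v
    ∂J v = trans (∂-restrict J₀⊆S v) (trans (cong (χ v ∧_) (∂J₀ v)) (absorb (T⊆χ v)))
      where
      absorb : ∀ {a t} → (t ≡ true → a ≡ true) → a ∧ t ≡ t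
      absorb {t = true}  imp rewrite imp refl = refl
      absorb {t = false} _   = Boolₚ.∧-zeroʳ _
  ... | no ≢b = restrict J₀ △ restrict S
              , sub , within-△ (restrict-within J₀⊆S) (restrict-within (λ _ → id)) , ∂J
              , trans (cong (restrict J₀ s xor_) (restrict-true S χs s∈S)) (flip ≢b)
    where
    flip : ∀ {a b} → a ≢ b → a xor true ≡ b
    flip {true}  {true}  a≢b = contradiction refl a≢b
    flip {true}  {false} a≢b = refl
    flip {false} {true}  a≢b = refl
    flip {false} {false} a≢b = contradiction refl a≢b
    sub : (restrict J₀ △ restrict S) ⊆ S
    sub e JSe with restrict J₀ e in r
    ... | true  = J₀⊆S e (restrict-⊆ J₀ e r)
    ... | false = restrict-⊆ S e JSe
    ∂J : ∀ v → ∂ (restrict J₀ △ restrict S) v ≡ T v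
    ∂J v = begin
      ∂ (restrict J₀ △ restrict S) v       ≡⟨ ∂-△ (restrict J₀) (restrict S) v ⟩
      ∂ (restrict J₀) v xor ∂ (restrict S) v ≡⟨ cong₂ _xor_ (∂-restrict J₀⊆S v) (∂-restrict (λ _ → id) v) ⟩
      χ v ∧ ∂ J₀ v xor χ v ∧ ∂ S v         ≡⟨ cong₂ _xor_ (cong (χ v ∧_) (∂J₀ v)) (cong (χ v ∧_) (∂S v)) ⟩
      χ v ∧ T v xor χ v ∧ false            ≡⟨ absorb (T⊆χ v) ⟩
      T v                                  ∎
      where
      open ≡-Reasoning
      absorb : ∀ {a t} → (t ≡ true → a ≡ true) → a ∧ t xor a ∧ false ≡ t
      absorb {t = true}  imp rewrite imp refl = refl
      absorb {a} {false} _   rewrite Boolₚ.∧-zeroʳ a = refl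

  -- The contribution of one circuit when the crossing edge at `u` is a matching edge. `F` matches
  -- the other vertices of the class; `Z` and `D` are the parts of the two even sets inside it,
  -- where `D` is to be completed by the crossing edges in `Q`. The edge given by `gap` differs from
  -- `spoke u`, so it stays absent when `spoke u` is added to `F`. The field `near` keeps the value
  -- α away from the neighbours of `u`.
  record Half (u : V) (Q : EdgeSet G) : Set where
    field
      F Z D    : EdgeSet G
      F-within : Within F
      Z-within : Within Z
      D-within : Within D
      ∂F       : ∀ {v} → χ v ≡ true → ∂ F v ≡ not (does (v ≟ u))
      gap      : ∀ {v} → χ v ≡ true → ∃[ e ] (Incident G v e × F e ≡ false × e ≢ spoke u)
      F⊆Z      : F ⊆ Z
      ∂Z       : ∀ v → ∂ Z v ≡ false
      ∂D       : ∀ {v} → χ v ≡ true → ∂ D v ≡ ∂ Q v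
      near     : ∀ {e w f} → Joins e u w → χ w ≡ true → F f ≡ true → Incident G w f → D f ≡ true

  -- The half belonging to one circuit, for three crossing edges

  module _ (u : V) (χu : χ u ≡ true) (crossing₁ : crossing (spoke u) ≡ true)
           {e₂ e₃ : E} (crossing₂ : crossing e₂ ≡ true) (e₂≢e₁ : e₂ ≢ spoke u)
           (three-crossings : ∀ {e} → crossing e ≡ true → e ≡ spoke u ⊎ e ≡ e₂ ⊎ e ≡ e₃) where

    e₁ : E
    e₁ = spoke u

    Q : EdgeSet G
    Q = ⁅ e₁ ⁆ △ ⁅ e₂ ⁆

    Q-true : ∀ e → Q e ≡ true → e ≡ e₁ ⊎ e ≡ e₂
    Q-true e Qe with e ≟ e₁ | e ≟ e₂
    ... | yes eq | _      = inj₁ eq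
    ... | no _   | yes eq = inj₂ eq

    Q-e₁ : Q e₁ ≡ true
    Q-e₁ = cong₂ _xor_ (⁅⁆-self e₁) (⁅⁆-other (e₂≢e₁ ∘ sym))

    Q-e₂ : Q e₂ ≡ true
    Q-e₂ = cong₂ _xor_ (⁅⁆-other e₂≢e₁) (⁅⁆-self e₂)

    Q∩S : ∀ e → Q e ≡ true → S e ≡ false
    Q∩S e Qe with Q-true e Qe
    ... | inj₁ refl = spoke∉S where open Star (star u)
    ... | inj₂ refl = crossing∉S crossing₂

    ∂Q : ∀ v → ∂ Q v ≡ Q (spoke v)
    ∂Q = ∂-spokes Q∩S

    -- By `handshake` this is the parity of the crossing edges in `Q`, and there are two of them.
    Q-even : ⨁ (λ v → χ v ∧ ∂ Q v) ≡ false
    Q-even = begin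
      ⨁ (λ v → χ v ∧ ∂ Q v)        ≡⟨ handshake χ Q ⟩
      ⨁ (λ e → Q e ∧ crossing e)   ≡⟨ sum-cong-≗ (λ e → distrib (⁅ e₁ ⁆ e) (⁅ e₂ ⁆ e) (crossing e)) ⟩
      ⨁ (λ e → crossing e ∧ ⁅ e₁ ⁆ e xor crossing e ∧ ⁅ e₂ ⁆ e)
        ≡⟨ ∑-distrib-+ (λ e → crossing e ∧ ⁅ e₁ ⁆ e) (λ e → crossing e ∧ ⁅ e₂ ⁆ e) ⟩
      ⨁ (λ e → crossing e ∧ ⁅ e₁ ⁆ e) xor ⨁ (λ e → crossing e ∧ ⁅ e₂ ⁆ e)
        ≡⟨ cong₂ _xor_ (⨁-at crossing e₁) (⨁-at crossing e₂) ⟩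
      crossing e₁ xor crossing e₂  ≡⟨ cong₂ _xor_ crossing₁ crossing₂ ⟩
      false                        ∎
      where
      open ≡-Reasoning
      distrib : ∀ a b c → (a xor b) ∧ c ≡ c ∧ a xor c ∧ b
      distrib = solve 3 (λ a b c → (a :+ b) :* c := c :* a :+ c :* b) refl
        where open xor-∧-Solver

    open Star (star u) using (spoke∉S) renaming
      ( left to s; right to s′; left≢right to s≢s′; left∈S to s∈S; right∈S to s′∈S
      ; left-incident to u∈s; right-incident to u∈s′; spoke-incident to u∈e₁ )

    x y : V
    x = proj₁ (incident-joins u∈s)
    y = proj₁ (incident-joins u∈s′)

    s-joins : Joins s u x
    s-joins = proj₂ (incident-joins u∈s)

    s′-joins : Joins s′ u y
    s′-joins = proj₂ (incident-joins u∈s′)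

    χx : χ x ≡ true
    χx = joins-χ s∈S s-joins χu

    χy : χ y ≡ true
    χy = joins-χ s′∈S s′-joins χu

    u≢x : u ≢ x
    u≢x = joins-≢ s-joins

    u≢y : u ≢ y
    u≢y = joins-≢ s′-joins

    S-edge-at : ∀ {v p q e} → p ≢ q → S p ≡ true → S q ≡ true → Incident G v p → Incident G v q →
                S e ≡ true → Incident G v e → e ≡ p ⊎ e ≡ q
    S-edge-at {v} p≢q p∈S q∈S v∈p v∈q e∈S v∈e
      with three-cover p≢q (S≢¬S p∈S (Star.spoke∉S (star v))) (S≢¬S q∈S (Star.spoke∉S (star v)))
             v∈p v∈q (Star.spoke-incident (star v)) v∈e
    ... | inj₁ eq        = inj₁ eq
    ... | inj₂ (inj₁ eq) = inj₂ eq
    ... | inj₂ (inj₂ eq) = contradiction eq (S≢¬S e∈S (Star.spoke∉S (star v)))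

    ∂-at : ∀ J {v p q} → p ≢ q → S p ≡ true → S q ≡ true → Incident G v p → Incident G v q →
           ∂ J v ≡ J p xor (J q xor J (spoke v))
    ∂-at J {v} p≢q p∈S q∈S v∈p v∈q =
      ∂-three J p≢q (S≢¬S p∈S (Star.spoke∉S (star v))) (S≢¬S q∈S (Star.spoke∉S (star v)))
        v∈p v∈q (Star.spoke-incident (star v))

    -- Otherwise {u , x} would be the whole class, which is odd.
    x≢y : x ≢ y
    x≢y x≡y = contradiction (trans (sym odd) even) λ ()
      where
      x∈s′ : Joins s′ u x
      x∈s′ = subst (Joins s′ u) (sym x≡y) s′-joins

      closed : ∀ {e v w} → S e ≡ true → Joins e v w → v ≡ u ⊎ v ≡ x → w ≡ u ⊎ w ≡ x
      closed {w = w} e∈S eq v∈ = ends-in (edge-in v∈)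
        where
        edge-in : _ → _ ≡ s ⊎ _ ≡ s′
        edge-in (inj₁ refl) = S-edge-at s≢s′ s∈S s′∈S u∈s u∈s′ e∈S (joins-incidentˡ eq)
        edge-in (inj₂ refl) = S-edge-at s≢s′ s∈S s′∈S (joins-incidentʳ s-joins) (joins-incidentʳ x∈s′)
                                e∈S (joins-incidentˡ eq)
        ends-in : _ ≡ s ⊎ _ ≡ s′ → w ≡ u ⊎ w ≡ x
        ends-in (inj₁ refl) = joins-cover s-joins (joins-incidentʳ eq)
        ends-in (inj₂ refl) = joins-cover x∈s′ (joins-incidentʳ eq)

      pair : ∀ v → χ v ≡ does (v ≟ u) xor does (v ≟ x)
      pair v with v ≟ u | v ≟ x
      ... | yes v≡u  | yes v≡x = contradiction (trans (sym v≡u) v≡x) u≢x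
      ... | yes refl | no _     = χu
      ... | no _     | yes refl = χx
      ... | no v≢u   | no v≢x   = Boolₚ.¬-not λ χv →
        case reach-closed (λ w → w ≡ u ⊎ w ≡ x) closed (connected u v χu χv) (inj₁ refl) of λ where
          (inj₁ eq) → v≢u eq
          (inj₂ eq) → v≢x eq

      even : ⨁ χ ≡ false
      even = trans (sum-cong-≗ pair) (trans (∑-distrib-+ (λ v → does (v ≟ u)) (λ v → does (v ≟ x)))
               (cong₂ _xor_ (⨁-single u) (⨁-single x)))

    a b : E
    a = spoke x
    b = spoke y

    crossing-no-chord : ∀ {e v w} → crossing e ≡ true → Joins e v w → χ v ≡ true → χ w ≡ true → ⊥
    crossing-no-chord {e} cross eq χv χw with t , h ← joins-within eq χv χw
      with () ← trans (sym cross) (cong₂ _xor_ t h)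

    -- The far end of `e₁` lies outside the class, so `u` is its only end inside.
    spoke-≢e₁ : ∀ {v} → u ≢ v → χ v ≡ true → spoke v ≢ e₁
    spoke-≢e₁ {v} u≢v χv eq with w , e₁-joins ← incident-joins u∈e₁
      with joins-cover e₁-joins (subst (Incident G v) eq (Star.spoke-incident (star v)))
    ... | inj₁ refl = u≢v refl
    ... | inj₂ refl = crossing-no-chord crossing₁ e₁-joins χu χv

    class-neighbour : ∀ {e w} → Joins e u w → χ w ≡ true → (e ≡ s × w ≡ x) ⊎ (e ≡ s′ × w ≡ y)
    class-neighbour eq χw
      with three-cover s≢s′ (S≢¬S s∈S spoke∉S) (S≢¬S s′∈S spoke∉S) u∈s u∈s′ u∈e₁ (joins-incidentˡ eq)
    ... | inj₂ (inj₂ refl) = ⊥-elim (crossing-no-chord crossing₁ eq χu χw)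
    ... | inj₁ refl with joins-cover s-joins (joins-incidentʳ eq)
    ...   | inj₁ w≡u = contradiction (sym w≡u) (joins-≢ eq)
    ...   | inj₂ w≡x = inj₁ (refl , w≡x)
    class-neighbour eq χw | inj₂ (inj₁ refl) with joins-cover s′-joins (joins-incidentʳ eq)
    ...   | inj₁ w≡u = contradiction (sym w≡u) (joins-≢ eq)
    ...   | inj₂ w≡y = inj₂ (refl , w≡y)

    χ-s : χ (tl s) ≡ true
    χ-s = proj₁ (joins-within s-joins χu χx)

    -- The join `J` repairs on the circuit the boundary that the chords in `K` create, so `K`
    -- cancels.
    ∂-chord : ∀ J K → (∀ v → ∂ J v ≡ χ v ∧ ∂ Q v xor ∂ K v) → ∀ {v} → χ v ≡ true → ∂ (K △ J) v ≡ ∂ Q v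
    ∂-chord J K ∂J {v} χv = begin
      ∂ (K △ J) v                            ≡⟨ ∂-△ K J v ⟩
      ∂ K v xor ∂ J v                        ≡⟨ cong (∂ K v xor_) (∂J v) ⟩
      ∂ K v xor (χ v ∧ ∂ Q v xor ∂ K v)      ≡⟨ cong (λ z → ∂ K v xor (z ∧ ∂ Q v xor ∂ K v)) χv ⟩
      ∂ K v xor (∂ Q v xor ∂ K v)            ≡⟨ cancel (∂ K v) (∂ Q v) ⟩
      ∂ Q v                                  ∎
      where
      open ≡-Reasoning
      cancel : ∀ k q → k xor (q xor k) ≡ q
      cancel = solve 2 (λ k q → k :+ (q :+ k) := q) refl
        where open xor-∧-Solver

    chord-target : ∀ {K} → Within K → ∀ v → χ v ∧ ∂ Q v xor ∂ K v ≡ true → χ v ≡ true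
    chord-target {K} K-in v eq with χ v in χv
    ... | true  = refl
    ... | false = trans (sym (∂-outside K-in χv)) eq

    chord-even : ∀ K → ⨁ (λ v → χ v ∧ ∂ Q v xor ∂ K v) ≡ false
    chord-even K = trans (∑-distrib-+ (λ v → χ v ∧ ∂ Q v) (∂ K))
                     (cong₂ _xor_ Q-even (handshake-total K))

    -- `K` is the set of chords added to `D`. The last condition is dictated by parity: at `u`,
    -- exactly one of `s` and `s′` lies in `D`; the matching edges at `x` and `y` lie in `D` exactly
    -- when `D s` and `D s′` are the negations of `Q a xor K a` and `Q b xor K b`.
    Chord : Set
    Chord = ∃[ K ] (Within K × (∀ e → K e ≡ true → S e ≡ false) × (Q a xor K a) xor (Q b xor K b) ≡ true)

    -- If just one of `a` and `b` lies in `Q`, no chord is added. They cannot both lie in `Q`, where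
    -- only `e₂` is available to them. If neither does, they cannot both be crossing, since only
    -- `e₃` is left; one that is not crossing is a chord and is added.
    choose-chord : a ≢ b → Chord
    choose-chord a≢b = by (Q a) (Q b) refl refl
      where
      a≢e₁ : a ≢ e₁
      a≢e₁ = spoke-≢e₁ u≢x χx
      b≢e₁ : b ≢ e₁
      b≢e₁ = spoke-≢e₁ u≢y χy

      second : ∀ {e} → e ≢ e₁ → Q e ≡ true → e ≡ e₂
      second {e} e≢e₁ Qe with Q-true e Qe
      ... | inj₁ eq = contradiction eq e≢e₁
      ... | inj₂ eq = eq

      third : ∀ {e} → e ≢ e₁ → Q e ≡ false → crossing e ≡ true → e ≡ e₃
      third e≢e₁ ¬Qe cross with three-crossings cross
      ... | inj₁ eq          = contradiction eq e≢e₁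
      ... | inj₂ (inj₁ refl) = contradiction (trans (sym Q-e₂) ¬Qe) λ ()
      ... | inj₂ (inj₂ eq)   = eq

      singleton-within : ∀ {v} → χ v ≡ true → crossing (spoke v) ≡ false → Within ⁅ spoke v ⁆
      singleton-within {v} χv ¬cross e eq with refl ← ⁅⁆-true {spoke v} {e} eq =
        both (Star.spoke-incident (star v))
        where
        both : Incident G v e → χ (tl e) ≡ true × χ (hd e) ≡ true
        both (inj₁ eq) = let t = trans (cong χ (sym eq)) χv in t , trans (sym (xor-false⇒≡ ¬cross)) t
        both (inj₂ eq) = let h = trans (cong χ (sym eq)) χv in trans (xor-false⇒≡ ¬cross) h , h

      singleton-spoke : ∀ v e → ⁅ spoke v ⁆ e ≡ true → S e ≡ false
      singleton-spoke v e eq with refl ← ⁅⁆-true {spoke v} {e} eq = Star.spoke∉S (star v)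

      by : ∀ p q → Q a ≡ p → Q b ≡ q → Chord
      by true  true  Qa Qb = contradiction (trans (second a≢e₁ Qa) (sym (second b≢e₁ Qb))) a≢b
      by true  false Qa Qb = ∅ , (λ _ ()) , (λ _ ()) , cong₂ (λ p q → (p xor false) xor (q xor false)) Qa Qb
      by false true  Qa Qb = ∅ , (λ _ ()) , (λ _ ()) , cong₂ (λ p q → (p xor false) xor (q xor false)) Qa Qb
      by false false Qa Qb with crossing a in cross-a | crossing b in cross-b
      ... | true  | true  = contradiction (trans (third a≢e₁ Qa cross-a) (sym (third b≢e₁ Qb cross-b))) a≢b
      ... | false | _     = ⁅ a ⁆ , singleton-within χx cross-a , singleton-spoke x
                          , cong₂ _xor_ (cong₂ _xor_ Qa (⁅⁆-self a)) (cong₂ _xor_ Qb (⁅⁆-other (a≢b ∘ sym)))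
      ... | true  | false = ⁅ b ⁆ , singleton-within χy cross-b , singleton-spoke y
                          , cong₂ _xor_ (cong₂ _xor_ Qa (⁅⁆-other a≢b)) (cong₂ _xor_ Qb (⁅⁆-self b))

    spoke-gap : ∀ {M} v → M ⊆ S → M (spoke v) ≡ false
    spoke-gap v M⊆S = Boolₚ.¬-not λ Mf →
      contradiction (trans (sym (M⊆S _ Mf)) (Star.spoke∉S (star v))) λ ()

    -- Together with `K`, such a join is odd at every vertex of the class except `u`. Leaving out
    -- `s` selects, of the two possible joins, the one that also leaves out `s′` when `K` is even at
    -- `u`.
    Matching : EdgeSet G → Set
    Matching K = Join (λ v → χ v xor (does (v ≟ u) xor ∂ K v)) s false

    matching : ∀ {K} → Within K → Matching K
    matching {K} K-in = join-at _ target even s s∈S χ-s false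
      where
      target : ∀ v → χ v xor (does (v ≟ u) xor ∂ K v) ≡ true → χ v ≡ true
      target v eq with χ v in χv
      ... | true  = refl
      ... | false with v ≟ u
      ...   | yes refl = trans (sym χv) χu
      ...   | no _     = trans (sym (∂-outside K-in χv)) eq
      even : ⨁ (λ v → χ v xor (does (v ≟ u) xor ∂ K v)) ≡ false
      even = trans (∑-distrib-+ χ (λ v → does (v ≟ u) xor ∂ K v))
               (cong₂ _xor_ odd (trans (∑-distrib-+ (λ v → does (v ≟ u)) (∂ K))
                 (cong₂ _xor_ (⨁-single u) (handshake-total K))))

    -- `M` is even at `u` and contains neither `s` nor the spoke there.
    matching-s′ : ∀ {K M} → M ⊆ S → (∀ v → ∂ M v ≡ χ v xor (does (v ≟ u) xor ∂ K v)) →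
                  M s ≡ false → ∂ K u ≡ false → M s′ ≡ false
    matching-s′ {K} {M} M⊆S ∂M Ms ∂Ku = begin
      M s′                           ≡⟨ Boolₚ.xor-identityʳ (M s′) ⟨
      M s′ xor false                 ≡⟨ cong (M s′ xor_) (spoke-gap u M⊆S) ⟨
      M s′ xor M e₁                  ≡⟨ cong (_xor (M s′ xor M e₁)) Ms ⟨
      M s xor (M s′ xor M e₁)        ≡⟨ ∂-star M u ⟨
      ∂ M u                          ≡⟨ ∂M u ⟩
      χ u xor (does (u ≟ u) xor ∂ K u) ≡⟨ cong₂ _xor_ χu (cong₂ _xor_ (dec-true (u ≟ u) refl) ∂Ku) ⟩
      false                          ∎
      where open ≡-Reasoning

    -- Here `F` consists of alternate edges and `Z` is the whole circuit. The prescribed membership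
    -- of `s` in `J` settles the matching edge at `x`; the parity condition on the chord then
    -- settles the one at `y`.
    half-without-triangle : (chord : Chord) → Matching ∅ →
      Join (λ v → χ v ∧ ∂ Q v xor ∂ (proj₁ chord) v) s (not (Q a xor proj₁ chord a)) → Half u Q
    half-without-triangle (K , K-in , K∩S , Kab) (M , M⊆S , M-in , ∂M , Ms) (J , J⊆S , J-in , ∂J , Js) =
      record
        { F = M ; Z = restrict S ; D = D
        ; F-within = M-in ; Z-within = restrict-within (λ _ → id) ; D-within = within-△ K-in J-in
        ; ∂F = λ {v} χv → trans (∂M v) (trans (cong₂ _xor_ χv (cong (does (v ≟ u) xor_) (∂-∅ v)))
                 (cong not (Boolₚ.xor-identityʳ (does (v ≟ u)))))
        ; gap = gap
        ; F⊆Z = λ e Me → restrict-true S (proj₁ (M-in e Me)) (M⊆S e Me)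
        ; ∂Z = λ v → trans (∂-restrict (λ _ → id) v) (trans (cong (χ v ∧_) (∂S v)) (Boolₚ.∧-zeroʳ (χ v)))
        ; ∂D = ∂D
        ; near = near
        }
      where
      D : EdgeSet G
      D = K △ J

      ∂D : ∀ {v} → χ v ≡ true → ∂ D v ≡ ∂ Q v
      ∂D = ∂-chord J K ∂J

      gap : ∀ {v} → χ v ≡ true → ∃[ e ] (Incident G v e × M e ≡ false × e ≢ e₁)
      gap {v} χv with v ≟ u
      ... | yes refl = s , u∈s , Ms , S≢¬S s∈S spoke∉S
      ... | no v≢u   = spoke v , Star.spoke-incident (star v) , spoke-gap v M⊆S , spoke-≢e₁ (v≢u ∘ sym) χv

      on-S : ∀ {e} → S e ≡ true → D e ≡ J e
      on-S {e} e∈S = cong (_xor J e) (Boolₚ.¬-not λ Ke → contradiction (trans (sym e∈S) (K∩S e Ke)) λ ())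

      on-spoke : ∀ v → D (spoke v) ≡ K (spoke v)
      on-spoke v = trans (cong (K (spoke v) xor_) (spoke-gap v J⊆S)) (Boolₚ.xor-identityʳ _)

      Ds : D s ≡ not (Q a xor K a)
      Ds = trans (on-S s∈S) Js

      -- At `u` the boundary of `D` is that of `Q`, which contains `e₁`, while `D` itself does not;
      -- so exactly one of `s` and `s′` lies in `D`.
      Ds′ : D s′ ≡ not (Q b xor K b)
      Ds′ = opposite (Q a xor K a) (Q b xor K b) (D s′) Kab (begin
        not (Q a xor K a) xor (D s′ xor false)
          ≡⟨ cong₂ (λ p q → p xor (D s′ xor q)) Ds (crossing-∉ (within-△ K-in J-in) crossing₁) ⟨
        D s xor (D s′ xor D e₁) ≡⟨ ∂-star D u ⟨
        ∂ D u                   ≡⟨ ∂D χu ⟩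
        ∂ Q u                   ≡⟨ ∂Q u ⟩
        Q e₁                    ≡⟨ Q-e₁ ⟩
        true                    ∎)
        where
        open ≡-Reasoning
        opposite : ∀ p q d → p xor q ≡ true → not p xor (d xor false) ≡ true → d ≡ not q
        opposite true  false true  _ _ = refl
        opposite false true  false _ _ = refl

      -- The edges at `z` are `t`, the matching edge `f` and the spoke. As `D t` is known, the
      -- parity of `D` at `z` forces `f` into `D`.
      near-at : ∀ {t z f} → Joins t u z → S t ≡ true → χ z ≡ true → M t ≡ false →
                D t ≡ not (Q (spoke z) xor K (spoke z)) → M f ≡ true → Incident G z f → D f ≡ true
      near-at {t} {z} {f} t-joins t∈S χz Mt Dt Mf z∈f = forced (Q (spoke z)) (K (spoke z)) (D f) (begin
        not (Q (spoke z) xor K (spoke z)) xor (D f xor K (spoke z))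
          ≡⟨ cong₂ (λ p q → p xor (D f xor q)) Dt (on-spoke z) ⟨
        D t xor (D f xor D (spoke z))
          ≡⟨ ∂-at D t≢f t∈S (M⊆S f Mf) (joins-incidentʳ t-joins) z∈f ⟨
        ∂ D z        ≡⟨ ∂D χz ⟩
        ∂ Q z        ≡⟨ ∂Q z ⟩
        Q (spoke z)  ∎)
        where
        open ≡-Reasoning
        t≢f : t ≢ f
        t≢f refl = contradiction (trans (sym Mf) Mt) λ ()
        forced : ∀ q k d → not (q xor k) xor (d xor k) ≡ q → d ≡ true
        forced q     k     true  _ = refl
        forced true  true  false ()
        forced true  false false ()
        forced false true  false ()
        forced false false false ()

      near : ∀ {e w f} → Joins e u w → χ w ≡ true → M f ≡ true → Incident G w f → D f ≡ true
      near eq χw Mf w∈f with class-neighbour eq χw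
      ... | inj₁ (_ , refl) = near-at s-joins s∈S χx Ms Ds Mf w∈f
      ... | inj₂ (_ , refl) = near-at s′-joins s′∈S χy (matching-s′ {∅} M⊆S ∂M Ms (∂-∅ u)) Ds′ Mf w∈f

    joins-singleton-within : ∀ {e v w} → Joins e v w → χ v ≡ true → χ w ≡ true → Within ⁅ e ⁆
    joins-singleton-within {e} eq χv χw f f∈ with refl ← ⁅⁆-true {e} {f} f∈ = joins-within eq χv χw

    -- The vertices `u`, `x`, `y` span a triangle. The chord `a` matches `x` with `y`, and alternate
    -- edges match the rest of the circuit. Since `J` lies in `S`, the chord belongs to `D`; it is
    -- the only edge of `F` at `x` and `y`, which gives `near`.
    half-with-triangle : Joins a x y → b ≡ a → Matching ⁅ a ⁆ →
      Join (λ v → χ v ∧ ∂ Q v xor ∂ ⁅ a ⁆ v) s false → Half u Q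
    half-with-triangle a-joins b≡a (M , M⊆S , M-in , ∂M , Ms) (J , J⊆S , J-in , ∂J , _) =
      record
        { F = F ; Z = Z ; D = D
        ; F-within = within-△ a-in M-in
        ; Z-within = within-△ (restrict-within (λ _ → id)) (within-△ s-in (within-△ s′-in a-in))
        ; D-within = within-△ a-in J-in
        ; ∂F = ∂F
        ; gap = gap
        ; F⊆Z = F⊆Z
        ; ∂Z = ∂Z
        ; ∂D = ∂-chord J ⁅ a ⁆ ∂J
        ; near = near
        }
      where
      open ≡-Reasoning

      F Z D : EdgeSet G
      F = ⁅ a ⁆ △ M
      -- Adding the triangle reroutes the circuit past `u`: `s` and `s′` are replaced by `a`.
      Z = restrict S △ ⁅ s ⁆ △ ⁅ s′ ⁆ △ ⁅ a ⁆
      D = ⁅ a ⁆ △ J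

      s-in : Within ⁅ s ⁆
      s-in = joins-singleton-within s-joins χu χx
      s′-in : Within ⁅ s′ ⁆
      s′-in = joins-singleton-within s′-joins χu χy
      a-in : Within ⁅ a ⁆
      a-in = joins-singleton-within a-joins χx χy

      ∂a-joins : ∀ v → ∂ ⁅ a ⁆ v ≡ does (v ≟ x) xor does (v ≟ y)
      ∂a-joins v = trans (∂-⁅⁆ a v) (joins-inc a-joins v)

      ∂F : ∀ {v} → χ v ≡ true → ∂ F v ≡ not (does (v ≟ u))
      ∂F {v} χv = begin
        ∂ F v                        ≡⟨ ∂-△ ⁅ a ⁆ M v ⟩
        ∂ ⁅ a ⁆ v xor ∂ M v          ≡⟨ cong (∂ ⁅ a ⁆ v xor_) (trans (∂M v) (cong (_xor (does (v ≟ u) xor ∂ ⁅ a ⁆ v)) χv)) ⟩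
        ∂ ⁅ a ⁆ v xor (true xor (does (v ≟ u) xor ∂ ⁅ a ⁆ v)) ≡⟨ cancel (∂ ⁅ a ⁆ v) (does (v ≟ u)) ⟩
        not (does (v ≟ u))           ∎
        where
        cancel : ∀ k d → k xor (true xor (d xor k)) ≡ not d
        cancel true  true  = refl
        cancel true  false = refl
        cancel false true  = refl
        cancel false false = refl

      ∂Z : ∀ v → ∂ Z v ≡ false
      ∂Z v = begin
        ∂ Z v
          ≡⟨ ∂-△ (restrict S) (⁅ s ⁆ △ ⁅ s′ ⁆ △ ⁅ a ⁆) v ⟩
        ∂ (restrict S) v xor ∂ (⁅ s ⁆ △ ⁅ s′ ⁆ △ ⁅ a ⁆) v
          ≡⟨ cong₂ _xor_ (trans (∂-restrict (λ _ → id) v) (cong (χ v ∧_) (∂S v)))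
               (trans (∂-△ ⁅ s ⁆ (⁅ s′ ⁆ △ ⁅ a ⁆) v) (cong (∂ ⁅ s ⁆ v xor_) (∂-△ ⁅ s′ ⁆ ⁅ a ⁆ v))) ⟩
        (χ v ∧ false) xor (∂ ⁅ s ⁆ v xor (∂ ⁅ s′ ⁆ v xor ∂ ⁅ a ⁆ v))
          ≡⟨ cong₂ _xor_ (Boolₚ.∧-zeroʳ (χ v))
               (cong₂ _xor_ (trans (∂-⁅⁆ s v) (joins-inc s-joins v))
                 (cong₂ _xor_ (trans (∂-⁅⁆ s′ v) (joins-inc s′-joins v)) (∂a-joins v))) ⟩
        (does (v ≟ u) xor does (v ≟ x)) xor ((does (v ≟ u) xor does (v ≟ y)) xor (does (v ≟ x) xor does (v ≟ y)))
          ≡⟨ cancel (does (v ≟ u)) (does (v ≟ x)) (does (v ≟ y)) ⟩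
        false ∎
        where
        cancel : ∀ p q r → (p xor q) xor ((p xor r) xor (q xor r)) ≡ false
        cancel = solve 3 (λ p q r → (p :+ q) :+ ((p :+ r) :+ (q :+ r)) := con false) refl
          where open xor-∧-Solver

      a∉S : S a ≡ false
      a∉S = Star.spoke∉S (star x)

      Ms′ : M s′ ≡ false
      Ms′ = matching-s′ {⁅ a ⁆} M⊆S ∂M Ms
              (trans (∂a-joins u) (cong₂ _xor_ (dec-false (u ≟ x) u≢x) (dec-false (u ≟ y) u≢y)))

      avoids : ∀ {e f} → M e ≡ true → M f ≡ false → e ≢ f
      avoids Me ¬Mf refl = contradiction (trans (sym Me) ¬Mf) λ ()

      F⊆Z : F ⊆ Z
      F⊆Z e Fe with e ≟ a
      ... | yes refl = cong₂ _xor_ (trans (cong (χ (tl a) ∧_) a∉S) (Boolₚ.∧-zeroʳ _))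
                         (cong₂ _xor_ (⁅⁆-other (S≢¬S s∈S a∉S ∘ sym))
                           (cong (_xor true) (⁅⁆-other (S≢¬S s′∈S a∉S ∘ sym))))
      ... | no _ = cong₂ _xor_ (restrict-true S (proj₁ (M-in e Fe)) (M⊆S e Fe))
                     (cong₂ _xor_ (⁅⁆-other (avoids Fe Ms)) (cong (_xor false) (⁅⁆-other (avoids Fe Ms′))))

      gap : ∀ {v} → χ v ≡ true → ∃[ e ] (Incident G v e × F e ≡ false × e ≢ e₁)
      gap {v} χv with v ≟ u | v ≟ x | v ≟ y
      ... | yes refl | _        | _        = s , u∈s , cong₂ _xor_ (⁅⁆-other (S≢¬S s∈S a∉S)) Ms , S≢¬S s∈S spoke∉S
      ... | no _     | yes refl | _        =
        s , joins-incidentʳ s-joins , cong₂ _xor_ (⁅⁆-other (S≢¬S s∈S a∉S)) Ms , S≢¬S s∈S spoke∉S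
      ... | no _     | no _     | yes refl =
        s′ , joins-incidentʳ s′-joins , cong₂ _xor_ (⁅⁆-other (S≢¬S s′∈S a∉S)) Ms′ , S≢¬S s′∈S spoke∉S
      ... | no v≢u   | no v≢x   | no v≢y   =
        spoke v , Star.spoke-incident (star v) , cong₂ _xor_ (⁅⁆-other spoke≢a) (spoke-gap v M⊆S)
        , spoke-≢e₁ (v≢u ∘ sym) χv
        where
        spoke≢a : spoke v ≢ a
        spoke≢a eq with joins-cover a-joins (subst (Incident G v) eq (Star.spoke-incident (star v)))
        ... | inj₁ v≡x = v≢x v≡x
        ... | inj₂ v≡y = v≢y v≡y

      near-at : ∀ {t z f} → Joins t u z → S t ≡ true → χ z ≡ true → M t ≡ false → ∂ ⁅ a ⁆ z ≡ true →
                F f ≡ true → Incident G z f → D f ≡ true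
      near-at {t} {z} {f} t-joins t∈S χz Mt ∂az Ff z∈f with f ≟ a
      ... | yes refl = cong not (spoke-gap x J⊆S)
      -- Another edge of `F` at `z` would belong to `M`, which is even at `z` but contains neither
      -- `t` nor the spoke.
      ... | no _ = contradiction (begin
        true                          ≡⟨ cong₂ _xor_ Mt (cong₂ _xor_ Ff (spoke-gap z M⊆S)) ⟨
        M t xor (M f xor M (spoke z))
          ≡⟨ ∂-at M (avoids Ff Mt ∘ sym) t∈S (M⊆S f Ff) (joins-incidentʳ t-joins) z∈f ⟨
        ∂ M z                         ≡⟨ ∂M z ⟩
        χ z xor (does (z ≟ u) xor ∂ ⁅ a ⁆ z)
          ≡⟨ cong₂ _xor_ χz (cong₂ _xor_ (dec-false (z ≟ u) (joins-≢ t-joins ∘ sym)) ∂az) ⟩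
        false                         ∎) λ ()

      near : ∀ {e w f} → Joins e u w → χ w ≡ true → F f ≡ true → Incident G w f → D f ≡ true
      near eq χw Ff w∈f with class-neighbour eq χw
      ... | inj₁ (_ , refl) = near-at s-joins s∈S χx Ms
              (trans (∂-⁅⁆ a x) (inc-true (joins-incidentˡ a-joins))) Ff w∈f
      ... | inj₂ (_ , refl) = near-at s′-joins s′∈S χy Ms′
              (trans (∂-⁅⁆ a y) (inc-true (joins-incidentʳ a-joins))) Ff w∈f

    -- If the two neighbours of `u` on the circuit share their spoke, that spoke is a chord joining
    -- them. Otherwise `choose-chord` applies.
    half : Half u Q
    half with a ≟ b
    ... | no a≢b = let chord = choose-chord a≢b ; K = proj₁ chord ; K-in = proj₁ (proj₂ chord) in
      half-without-triangle chord (matching (λ _ ()))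
        (join-at _ (chord-target K-in) (chord-even K) s s∈S χ-s (not (Q a xor K a)))
    ... | yes a≡b = half-with-triangle a-joins (sym a≡b) (matching a-in)
        (join-at _ (chord-target a-in) (chord-even ⁅ a ⁆) s s∈S χ-s false)
      where
      a-joins : Joins a x y
      a-joins with w , a-xw ← incident-joins (Star.spoke-incident (star x))
        with joins-cover a-xw (subst (Incident G y) (sym a≡b) (Star.spoke-incident (star y)))
      ... | inj₁ y≡x = contradiction (sym y≡x) x≢y
      ... | inj₂ refl = a-xw
      a-in : Within ⁅ a ⁆
      a-in = joins-singleton-within a-joins χx χy

-- Constant flows for even or connected 2-factors

module Classes (G : Graph) (cubic : Cubic G) (S : EdgeSet G) (twoFactor : TwoFactor G S) where
  open EdgeSpace G
  open CubicTwoFactor G cubic S twoFactor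

  F₀ : EdgeSet G
  F₀ = complement G S

  ∉F₀ : ∀ {e} → S e ≡ true → F₀ e ≡ false
  ∉F₀ s = cong not s

  F₀∉S : ∀ e → F₀ e ≡ true → S e ≡ false
  F₀∉S e Fe = trans (sym (Boolₚ.not-involutive (S e))) (cong not Fe)

  ∂F₀ : ∀ v → ∂ F₀ v ≡ true
  ∂F₀ v = trans (∂-spokes F₀∉S v) (cong not (Star.spoke∉S (star v)))

  F₀-perfect : PerfectMatching G F₀
  F₀-perfect = perfect ∂F₀ λ v →
    Star.left (star v) , Star.left-incident (star v) , ∉F₀ (Star.left∈S (star v))

  ⊆S-∉ : ∀ {J e} → J ⊆ S → F₀ e ≡ true → J e ≡ false
  ⊆S-∉ {e = e} J⊆S Fe = Boolₚ.¬-not λ Je → contradiction (trans (sym (J⊆S e Je)) (F₀∉S e Fe)) λ ()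

  -- `F₀` and `J` are both odd at every vertex, so their sum is even. It covers `F₀`, giving the
  -- constant value α, and without β there is no conflict.
  solution-constant : ∃[ J ] (J ⊆ S × ∀ v → ∂ J v ≡ true) → Solution
  solution-constant (J , J⊆S , ∂J) =
    solution F₀ (F₀ △ J) ∅ F₀-perfect
      (λ v → trans (∂-△ F₀ J v) (cong₂ _xor_ (∂F₀ v) (∂J v))) ∂-∅
      (λ e Fe eq → contradiction (trans (sym (cong₂ _xor_ Fe (⊆S-∉ J⊆S Fe))) (cong proj₁ eq)) λ ())
      (λ _ _ _ _ _ _ → (λ { (_ , _ , _ , θg) → contradiction (cong proj₂ θg) λ () })
                     , (λ { (_ , _ , _ , θg) → contradiction (cong proj₂ θg) λ () }))

  -- The number of vertices is even, because `F₀` is odd at each of them.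
  solution-connected : (∀ u v → Reach G S u v) → Solution
  solution-connected connected = solution-constant
    (join (λ _ → true) (λ u v _ _ → connected u v)
      (trans (sum-cong-≗ (sym ∘ ∂F₀)) (handshake-total F₀)))

  module _ (χ : V → Bool) (connected : ∀ u v → χ u ≡ χ v → Reach G S u v) where

    -- A join is found for each class separately; the targets are disjoint and add up to `T`.
    join-classes : ∀ (T : V → Bool) → ⨁ (λ v → χ v ∧ T v) ≡ false → ⨁ (λ v → not (χ v) ∧ T v) ≡ false →
                   ∃[ J ] (J ⊆ S × ∀ v → ∂ J v ≡ T v)
    join-classes T even even′
      = combine (join (λ v → χ v ∧ T v)
                  (λ u v Tu Tv → connected u v (trans (in-class Tu) (sym (in-class Tv)))) even)
                (join (λ v → not (χ v) ∧ T v)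
                  (λ u v Tu Tv → connected u v (Boolₚ.not-injective (trans (in-class Tu) (sym (in-class Tv))))) even′)
      where
      in-class : ∀ {a b} → a ∧ b ≡ true → a ≡ true
      in-class = Boolₚ.∧-conicalˡ _ _
      recombine : ∀ a t → a ∧ t xor not a ∧ t ≡ t
      recombine true  true  = refl
      recombine true  false = refl
      recombine false t     = refl
      combine : ∃[ J ] (J ⊆ S × ∀ v → ∂ J v ≡ χ v ∧ T v) → ∃[ J ] (J ⊆ S × ∀ v → ∂ J v ≡ not (χ v) ∧ T v) →
                ∃[ J ] (J ⊆ S × ∀ v → ∂ J v ≡ T v)
      combine (J , J⊆S , ∂J) (K , K⊆S , ∂K) =
        J △ K , sub , λ v → trans (∂-△ J K v) (trans (cong₂ _xor_ (∂J v) (∂K v)) (recombine (χ v) (T v)))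
        where
        sub : (J △ K) ⊆ S
        sub e JKe with J e in Je
        ... | true  = J⊆S e Je
        ... | false = K⊆S e JKe

    solution-even : ⨁ χ ≡ false → ⨁ (λ v → not (χ v)) ≡ false → Solution
    solution-even even even′ = solution-constant (join-classes (λ _ → true)
      (trans (sum-cong-≗ (λ v → Boolₚ.∧-identityʳ (χ v))) even)
      (trans (sum-cong-≗ (λ v → Boolₚ.∧-identityʳ (not (χ v)))) even′))

  -- Two odd circuits: unlinked crossing edges and three crossing edges

  module OddClasses (χ : V → Bool) (connected : ∀ u v → χ u ≡ χ v → Reach G S u v)
                    (monochromatic : ∀ e → S e ≡ true → χ (tl e) ≡ χ (hd e))
                    (odd : ⨁ χ ≡ true) (odd′ : ⨁ (λ v → not (χ v)) ≡ true) where

    χ′ : V → Bool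
    χ′ v = not (χ v)

    module A = Side G cubic S twoFactor χ (λ u v p q → connected u v (trans p (sym q))) monochromatic odd
    module B = Side G cubic S twoFactor χ′
      (λ u v p q → connected u v (Boolₚ.not-injective (trans p (sym q))))
      (λ e s → cong not (monochromatic e s)) odd′

    open A using (crossing; crossing∉S; joins-χ)

    crossing′ : ∀ e → B.crossing e ≡ crossing e
    crossing′ e = Boolₚ.xor-annihilates-not (χ (tl e)) (χ (hd e))

    record CrossingEnds (e : E) : Set where
      field
        u u′  : V
        joins : Joins e u u′
        χu    : χ u ≡ true
        χu′   : χ u′ ≡ false
        e∉S   : S e ≡ false

      spoke-u : spoke u ≡ e
      spoke-u = sym (Star.spoke-unique (star u) e∉S (joins-incidentˡ joins))

      spoke-u′ : spoke u′ ≡ e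
      spoke-u′ = sym (Star.spoke-unique (star u′) e∉S (joins-incidentʳ joins))

    crossing-ends : ∀ {e} → crossing e ≡ true → CrossingEnds e
    crossing-ends {e} cross = by (χ (tl e)) (χ (hd e)) refl refl cross
      where
      by : ∀ p q → χ (tl e) ≡ p → χ (hd e) ≡ q → p xor q ≡ true → CrossingEnds e
      by true  false t h _ = record { joins = joins-ends e ; χu = t ; χu′ = h ; e∉S = crossing∉S cross }
      by false true  t h _ = record { joins = joins-sym (joins-ends e) ; χu = h ; χu′ = t ; e∉S = crossing∉S cross }

    -- The flow takes the value α on f, β on e and α + β on all other edges of F₀.
    solution-unlinked : ∀ {e f} → crossing e ≡ true → crossing f ≡ true → e ≢ f →
      (∀ {g v w} → S g ≡ true → Joins g v w → Incident G v e → Incident G w f → ⊥) → Solution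
    solution-unlinked {e} {f} cross-e cross-f e≢f unlinked =
      assemble (join-minus e cross-e) (join-minus f cross-f)
      where
      -- Toggling a crossing edge in `F₀` changes the parity at one vertex of the class, so an even
      -- number of odd vertices remains in it.
      crossing-sum : ∀ χ₀ {e} → χ₀ (tl e) xor χ₀ (hd e) ≡ true → ⨁ χ₀ ≡ true →
                     ⨁ (λ v → χ₀ v ∧ ∂ (F₀ △ ⁅ e ⁆) v) ≡ false
      crossing-sum χ₀ {e} cross odd = begin
        ⨁ (λ v → χ₀ v ∧ ∂ (F₀ △ ⁅ e ⁆) v)
          ≡⟨ sum-cong-≗ (λ v → cong (χ₀ v ∧_) (trans (∂-△ F₀ ⁅ e ⁆ v) (cong (_xor ∂ ⁅ e ⁆ v) (∂F₀ v)))) ⟩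
        ⨁ (λ v → χ₀ v ∧ (true xor ∂ ⁅ e ⁆ v))
          ≡⟨ sum-cong-≗ (λ v → Boolₚ.∧-distribˡ-xor (χ₀ v) true (∂ ⁅ e ⁆ v)) ⟩
        ⨁ (λ v → χ₀ v ∧ true xor χ₀ v ∧ ∂ ⁅ e ⁆ v)
          ≡⟨ ∑-distrib-+ (λ v → χ₀ v ∧ true) (λ v → χ₀ v ∧ ∂ ⁅ e ⁆ v) ⟩
        ⨁ (λ v → χ₀ v ∧ true) xor ⨁ (λ v → χ₀ v ∧ ∂ ⁅ e ⁆ v)
          ≡⟨ cong₂ _xor_ (trans (sum-cong-≗ (λ v → Boolₚ.∧-identityʳ (χ₀ v))) odd) (handshake χ₀ ⁅ e ⁆) ⟩
        true xor ⨁ (λ g → ⁅ e ⁆ g ∧ (χ₀ (tl g) xor χ₀ (hd g)))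
          ≡⟨ cong not (sum-cong-≗ (λ g → Boolₚ.∧-comm (⁅ e ⁆ g) _)) ⟩
        true xor ⨁ (λ g → (χ₀ (tl g) xor χ₀ (hd g)) ∧ ⁅ e ⁆ g)
          ≡⟨ cong not (trans (⨁-at (λ g → χ₀ (tl g) xor χ₀ (hd g)) e) cross) ⟩
        false ∎
        where open ≡-Reasoning

      join-minus : ∀ e → crossing e ≡ true → ∃[ J ] (J ⊆ S × ∀ v → ∂ J v ≡ ∂ (F₀ △ ⁅ e ⁆) v)
      join-minus e cross = join-classes χ connected (∂ (F₀ △ ⁅ e ⁆))
        (crossing-sum χ cross odd) (crossing-sum χ′ (trans (crossing′ e) cross) odd′)

      assemble : ∃[ J ] (J ⊆ S × ∀ v → ∂ J v ≡ ∂ (F₀ △ ⁅ e ⁆) v) →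
                 ∃[ J ] (J ⊆ S × ∀ v → ∂ J v ≡ ∂ (F₀ △ ⁅ f ⁆) v) → Solution
      assemble (J , J⊆S , ∂J) (K , K⊆S , ∂K) =
        solution F₀ (J △ F₀ △ ⁅ e ⁆) (K △ F₀ △ ⁅ f ⁆) F₀-perfect
          (λ v → trans (∂-△ J (F₀ △ ⁅ e ⁆) v) (trans (cong (_xor _) (∂J v)) (Boolₚ.xor-same (∂ (F₀ △ ⁅ e ⁆) v))))
          (λ v → trans (∂-△ K (F₀ △ ⁅ f ⁆) v) (trans (cong (_xor _) (∂K v)) (Boolₚ.xor-same (∂ (F₀ △ ⁅ f ⁆) v))))
          -- On `F₀` the first coordinate vanishes only at `e` and the second only at `f`.
          (λ g Fg eq → e≢f (trans (sym (zero-at J⊆S Fg (cong proj₁ eq))) (zero-at K⊆S Fg (cong proj₂ eq))))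
          (λ g Fg p q Fp Fq →
            (λ { (tp , hq , θp , θq) → clash (joins-ends g) (F₀∉ Fg) Fp Fq tp hq θp θq }) ,
            (λ { (hp , tq , θp , θq) → clash (joins-sym (joins-ends g)) (F₀∉ Fg) Fp Fq hp tq θp θq }))
        where
        F₀∉ : ∀ {g} → F₀ g ≡ false → S g ≡ true
        F₀∉ {g} Fg = trans (sym (Boolₚ.not-involutive (S g))) (cong not Fg)

        zero-at : ∀ {J e g} → J ⊆ S → F₀ g ≡ true → (J △ F₀ △ ⁅ e ⁆) g ≡ false → g ≡ e
        zero-at {J} {e} {g} J⊆S Fg eq with g ≟ e
        ... | yes g≡e = g≡e
        ... | no _ = contradiction
          (trans (sym eq) (cong₂ _xor_ (⊆S-∉ J⊆S Fg) (cong (_xor false) Fg))) λ ()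

        -- The value α occurs only on `f` and β only on `e`, so a conflict would be a link between
        -- them.
        clash : ∀ {g v w p q} → Joins g v w → S g ≡ true → F₀ p ≡ true → F₀ q ≡ true →
                Incident G v p → Incident G w q →
                ((J △ F₀ △ ⁅ e ⁆) p , (K △ F₀ △ ⁅ f ⁆) p) ≡ α →
                ((J △ F₀ △ ⁅ e ⁆) q , (K △ F₀ △ ⁅ f ⁆) q) ≡ β → ⊥
        clash g-joins g∈S Fp Fq v∈p w∈q θp θq
          with refl ← zero-at K⊆S Fp (cong proj₂ θp)
          with refl ← zero-at J⊆S Fq (cong proj₁ θq)
          = unlinked g∈S (joins-sym g-joins) w∈q v∈p

    -- The halves of the two circuits are glued. `e₁` matches the vertices `u` and `u′` that they
    -- leave out; `Q` cancels the boundaries of both sets `D`, while the sets `Z` are even already.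
    -- As both `Z` avoid `e₁`, it is the one matching edge with value β.
    solution-three : ∀ {e₁ e₂ e₃} → crossing e₁ ≡ true → crossing e₂ ≡ true → e₂ ≢ e₁ →
      (∀ {e} → crossing e ≡ true → e ≡ e₁ ⊎ e ≡ e₂ ⊎ e ≡ e₃) → Solution
    solution-three {e₁} {e₂} {e₃} cross₁ cross₂ e₂≢e₁ only = assemble
      (subst (λ e → A.Half u (⁅ e ⁆ △ ⁅ e₂ ⁆)) spoke-u
        (A.half u χu (subst (λ e → crossing e ≡ true) (sym spoke-u) cross₁) cross₂
          (subst (e₂ ≢_) (sym spoke-u) e₂≢e₁)
          (λ cross → subst (λ e → _ ≡ e ⊎ _) (sym spoke-u) (only cross))))
      (subst (λ e → B.Half u′ (⁅ e ⁆ △ ⁅ e₂ ⁆)) spoke-u′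
        (B.half u′ (cong not χu′) (subst (λ e → B.crossing e ≡ true) (sym spoke-u′) (trans (crossing′ e₁) cross₁))
          (trans (crossing′ e₂) cross₂)
          (subst (e₂ ≢_) (sym spoke-u′) e₂≢e₁)
          (λ {e} cross → subst (λ e′ → _ ≡ e′ ⊎ _) (sym spoke-u′) (only (trans (sym (crossing′ e)) cross)))))
      where
      open CrossingEnds (crossing-ends cross₁) renaming (joins to e₁-joins)

      Q : EdgeSet G
      Q = ⁅ e₁ ⁆ △ ⁅ e₂ ⁆

      assemble : A.Half u Q → B.Half u′ Q → Solution
      assemble hA hB = solution F Z D (perfect ∂F gap) ∂Z ∂D nonzero
        (λ e Fe f g Ff Fg →
          (λ { (tf , hg , θf , θg) → clash (joins-sym (joins-ends e)) Fe Ff Fg tf hg θf θg }) ,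
          (λ { (hf , tg , θf , θg) → clash (joins-ends e) Fe Ff Fg hf tg θf θg }))
        where
        module hA = A.Half hA
        module hB = B.Half hB
        F Z D : EdgeSet G
        F = ⁅ e₁ ⁆ △ hA.F △ hB.F
        Z = hA.Z △ hB.Z
        D = Q △ hA.D △ hB.D

        χ-cases : ∀ v → χ v ≡ true ⊎ χ v ≡ false
        χ-cases v with χ v
        ... | true  = inj₁ refl
        ... | false = inj₂ refl

        separate : ∀ {v w} → χ v ≡ true → χ w ≡ false → v ≢ w
        separate χv χw refl = contradiction (trans (sym χv) χw) λ ()

        ∂-triple : ∀ J K L v → ∂ (J △ K △ L) v ≡ ∂ J v xor (∂ K v xor ∂ L v)
        ∂-triple J K L v = trans (∂-△ J (K △ L) v) (cong (∂ J v xor_) (∂-△ K L v))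

        ∂e₁ : ∀ v → ∂ ⁅ e₁ ⁆ v ≡ does (v ≟ u) xor does (v ≟ u′)
        ∂e₁ v = trans (∂-⁅⁆ e₁ v) (joins-inc e₁-joins v)

        ∂F : ∀ v → ∂ F v ≡ true
        ∂F v with χ-cases v
        ... | inj₁ χv = trans (∂-triple ⁅ e₁ ⁆ hA.F hB.F v)
          (trans (cong₂ _xor_ (trans (∂e₁ v) (cong (does (v ≟ u) xor_) (dec-false (v ≟ u′) (separate χv χu′))))
                   (cong₂ _xor_ (hA.∂F χv) (B.∂-outside hB.F-within (cong not χv))))
            (total (does (v ≟ u))))
          where
          total : ∀ p → (p xor false) xor (not p xor false) ≡ true
          total true  = refl
          total false = refl
        ... | inj₂ χv = trans (∂-triple ⁅ e₁ ⁆ hA.F hB.F v)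
          (trans (cong₂ _xor_ (trans (∂e₁ v) (cong (_xor does (v ≟ u′)) (dec-false (v ≟ u) (separate χu χv ∘ sym))))
                   (cong₂ _xor_ (A.∂-outside hA.F-within χv) (hB.∂F (cong not χv))))
            (total (does (v ≟ u′))))
          where
          total : ∀ p → p xor not p ≡ true
          total true  = refl
          total false = refl

        missA : ∀ {J e v} → A.Within J → χ v ≡ false → Incident G v e → J e ≡ false
        missA J-in χv v∈e = Boolₚ.¬-not λ Je →
          contradiction (trans (sym (A.within-incident J-in Je v∈e)) χv) λ ()

        missB : ∀ {J e v} → B.Within J → χ v ≡ true → Incident G v e → J e ≡ false
        missB J-in χv v∈e = Boolₚ.¬-not λ Je →
          contradiction (trans (sym (B.within-incident J-in Je v∈e)) (cong not χv)) λ ()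

        -- The edge left out by the half on the side of `v` differs from `e₁`, and the other half
        -- does not reach `v`.
        gap : ∀ v → ∃[ e ] (Incident G v e × F e ≡ false)
        gap v with χ-cases v
        ... | inj₁ χv = let e , v∈e , ¬Fe , e≢ = hA.gap χv in
          e , v∈e , cong₂ _xor_ (⁅⁆-other (λ eq → e≢ (trans eq (sym spoke-u))))
            (cong₂ _xor_ ¬Fe (missB hB.F-within χv v∈e))
        ... | inj₂ χv = let e , v∈e , ¬Fe , e≢ = hB.gap (cong not χv) in
          e , v∈e , cong₂ _xor_ (⁅⁆-other (λ eq → e≢ (trans eq (sym spoke-u′))))
            (cong₂ _xor_ (missA hA.F-within χv v∈e) ¬Fe)

        ∂Z : ∀ v → ∂ Z v ≡ false
        ∂Z v = trans (∂-△ hA.Z hB.Z v) (cong₂ _xor_ (hA.∂Z v) (hB.∂Z v))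

        ∂D : ∀ v → ∂ D v ≡ false
        ∂D v = trans (∂-triple Q hA.D hB.D v) (by-class (χ-cases v))
          where
          by-class : χ v ≡ true ⊎ χ v ≡ false → ∂ Q v xor (∂ hA.D v xor ∂ hB.D v) ≡ false
          by-class (inj₁ χv)
            rewrite hA.∂D χv | B.∂-outside hB.D-within (cong not χv) | Boolₚ.xor-identityʳ (∂ Q v) =
            Boolₚ.xor-same (∂ Q v)
          by-class (inj₂ χv)
            rewrite hB.∂D (cong not χv) | A.∂-outside hA.D-within χv = Boolₚ.xor-same (∂ Q v)

        cross₁′ : B.crossing e₁ ≡ true
        cross₁′ = trans (crossing′ e₁) cross₁

        Fe₁ : F e₁ ≡ true
        Fe₁ = cong₂ _xor_ (⁅⁆-self e₁) (cong₂ _xor_ (A.crossing-∉ hA.F-within cross₁) (B.crossing-∉ hB.F-within cross₁′))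

        De₁ : D e₁ ≡ true
        De₁ = cong₂ _xor_ (cong₂ _xor_ (⁅⁆-self e₁) (⁅⁆-other (e₂≢e₁ ∘ sym)))
                (cong₂ _xor_ (A.crossing-∉ hA.D-within cross₁) (B.crossing-∉ hB.D-within cross₁′))

        F-cases : ∀ e → F e ≡ true → e ≡ e₁ ⊎ hA.F e ≡ true ⊎ hB.F e ≡ true
        F-cases e Fe = by (xor-cases (⁅ e₁ ⁆ e) Fe)
          where
          by : ⁅ e₁ ⁆ e ≡ true ⊎ hA.F e xor hB.F e ≡ true → e ≡ e₁ ⊎ hA.F e ≡ true ⊎ hB.F e ≡ true
          by (inj₁ eq) = inj₁ (⁅⁆-true eq)
          by (inj₂ eq) = inj₂ (xor-cases (hA.F e) eq)

        Z-covers : ∀ e → F e ≡ true → e ≢ e₁ → Z e ≡ true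
        Z-covers e Fe e≢e₁ with F-cases e Fe
        ... | inj₁ eq         = contradiction eq e≢e₁
        ... | inj₂ (inj₁ FAe) = cong₂ _xor_ (hA.F⊆Z e FAe) (missB hB.Z-within (proj₁ (hA.F-within e FAe)) (inj₁ refl))
        ... | inj₂ (inj₂ FBe) = cong₂ _xor_
          (missA hA.Z-within (Boolₚ.not-injective (proj₁ (hB.F-within e FBe))) (inj₁ refl)) (hB.F⊆Z e FBe)

        only-e₁ : ∀ e → F e ≡ true → Z e ≡ false → e ≡ e₁
        only-e₁ e Fe ¬Ze = decidable-stable (e ≟ e₁) λ e≢e₁ →
          contradiction (trans (sym (Z-covers e Fe e≢e₁)) ¬Ze) λ ()

        nonzero : ∀ e → F e ≡ true → (Z e , D e) ≢ 𝟘
        nonzero e Fe eq with refl ← only-e₁ e Fe (cong proj₁ eq) =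
          contradiction (trans (sym De₁) (cong proj₂ eq)) λ ()

        Q-crosses : ∀ e → Q e ≡ true → crossing e ≡ true
        Q-crosses e Qe with xor-cases (⁅ e₁ ⁆ e) Qe
        ... | inj₁ eq = subst (λ f → crossing f ≡ true) (sym (⁅⁆-true eq)) cross₁
        ... | inj₂ eq = subst (λ f → crossing f ≡ true) (sym (⁅⁆-true eq)) cross₂

        Q∉ : ∀ {e} → χ (tl e) ≡ χ (hd e) → Q e ≡ false
        Q∉ {e} same = Boolₚ.¬-not λ Qe → contradiction
          (trans (sym (Q-crosses e Qe)) (trans (cong (_xor χ (hd e)) same) (Boolₚ.xor-same (χ (hd e))))) λ ()

        -- β occurs only on e₁, whose neighbours on S see only edges with value α + β.
        no-α-near : ∀ {e v w f} → Joins e v w → F e ≡ false → v ≡ u ⊎ v ≡ u′ →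
                    F f ≡ true → Incident G w f → D f ≡ true
        no-α-near {e} {v} {w} {f} eq ¬Fe v∈ Ff w∈f = by-end v∈
          where
          e≢e₁ : e ≢ e₁
          e≢e₁ refl = contradiction (trans (sym Fe₁) ¬Fe) λ ()

          in-S : spoke v ≡ e₁ → S e ≡ true
          in-S sv = Boolₚ.¬-not λ ¬Se → e≢e₁ (trans (Star.spoke-unique (star v) ¬Se (joins-incidentˡ eq)) sv)

          by-end : v ≡ u ⊎ v ≡ u′ → D f ≡ true
          by-end (inj₁ refl) = case F-cases f Ff of λ where
              (inj₁ refl) → case joins-cover e₁-joins w∈f of λ where
                (inj₁ w≡u)  → contradiction (sym w≡u) (joins-≢ eq)
                (inj₂ w≡u′) → contradiction w≡u′ (separate χw χu′)
              (inj₂ (inj₁ FAf)) → let t , h = hA.F-within f FAf in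
                cong₂ _xor_ (Q∉ (trans t (sym h))) (cong₂ _xor_ (hA.near eq χw FAf w∈f) (missB hB.D-within χw w∈f))
              (inj₂ (inj₂ FBf)) → contradiction (trans (sym FBf) (missB hB.F-within χw w∈f)) λ ()
            where
            χw : χ w ≡ true
            χw = joins-χ (in-S spoke-u) eq χu
          by-end (inj₂ refl) = case F-cases f Ff of λ where
              (inj₁ refl) → case joins-cover e₁-joins w∈f of λ where
                (inj₁ w≡u)  → contradiction (sym w≡u) (separate χu χw)
                (inj₂ w≡u′) → contradiction (sym w≡u′) (joins-≢ eq)
              (inj₂ (inj₁ FAf)) → contradiction (trans (sym FAf) (missA hA.F-within χw w∈f)) λ ()
              (inj₂ (inj₂ FBf)) → let t , h = hB.F-within f FBf in
                cong₂ _xor_ (Q∉ (Boolₚ.not-injective (trans t (sym h))))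
                  (cong₂ _xor_ (missA hA.D-within χw w∈f) (hB.near eq (cong not χw) FBf w∈f))
            where
            χw : χ w ≡ false
            χw = Boolₚ.not-injective (B.joins-χ (in-S spoke-u′) eq (cong not χu′))

        clash : ∀ {e v w f g} → Joins e v w → F e ≡ false → F f ≡ true → F g ≡ true →
                Incident G w f → Incident G v g → (Z f , D f) ≡ α → (Z g , D g) ≡ β → ⊥
        clash {f = f} {g} eq ¬Fe Ff Fg w∈f v∈g θf θg with refl ← only-e₁ g Fg (cong proj₁ θg) =
          contradiction (trans (sym (no-α-near eq ¬Fe (joins-cover e₁-joins v∈g) Ff w∈f)) (cong proj₂ θf)) λ ()

-- Two classes R true and R false of pairs of five points, without claws, split the ten pairs
-- into a pentagon and its complementary pentagram.
module TwoColouring {X : Set} (R : Bool → X → X → Set)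
                    (R-sym : ∀ {c x y} → R c x y → R c y x)
                    (R-total : ∀ {x y} → x ≢ y → R true x y ⊎ R false x y)
                    (claw-free : ∀ c {x y z w} → y ≢ z → y ≢ w → z ≢ w → R c x y → R c x z → R c x w → ⊥)
                    where

  Points : Set
  Points = Σ (Fin 5 → X) λ x → ∀ i j → x i ≡ x j → i ≡ j

  injective? : ∀ (π : Vec (Fin 5) 5) → Dec (∀ i j → lookup π i ≡ lookup π j → i ≡ j)
  injective? π = all? λ i → all? λ j → (lookup π i ≟ lookup π j) →-dec (i ≟ j)

  reorder : Points → (π : Vec (Fin 5) 5) → True (injective? π) → Points
  reorder (x , x-inj) π inj = x ∘ lookup π , λ i j eq → toWitness inj i j (x-inj _ _ eq)

  -- The false pairs follow the circuit 0 2 4 1 3, which is the order of the inner pentagram in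
  -- `petersenEndsV`.
  record Pentagon : Set where
    field
      points : Points
    x : Fin 5 → X
    x = proj₁ points
    field
      r₀₁ : R true (x 0F) (x 1F)
      r₁₂ : R true (x 1F) (x 2F)
      r₂₃ : R true (x 2F) (x 3F)
      r₃₄ : R true (x 3F) (x 4F)
      r₄₀ : R true (x 4F) (x 0F)
      r₀₂ : R false (x 0F) (x 2F)
      r₂₄ : R false (x 2F) (x 4F)
      r₄₁ : R false (x 4F) (x 1F)
      r₁₃ : R false (x 1F) (x 3F)
      r₃₀ : R false (x 3F) (x 0F)

  private
    module Steps (points : Points) where
      x : Fin 5 → X
      x = proj₁ points

      ≢? : Fin 5 → Fin 5 → Set
      ≢? i j = True (¬? (i ≟ j))

      distinct : ∀ i j → {≢? i j} → x i ≢ x j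
      distinct i j {i≢j} eq = toWitness i≢j (proj₂ points i j eq)

      colour : ∀ i j → {≢? i j} → R true (x i) (x j) ⊎ R false (x i) (x j)
      colour i j {i≢j} = R-total (distinct i j {i≢j})

      no-claw : ∀ c i j k l → {≢? j k} → {≢? j l} → {≢? k l} →
                R c (x i) (x j) → R c (x i) (x k) → R c (x i) (x l) → ⊥
      no-claw c i j k l {p} {q} {r} =
        claw-free c (distinct j k {p}) (distinct j l {q}) (distinct k l {r})

      -- Three pairs are still uncoloured. Claws at 3 and 4 exclude true for 2 3, a claw at 2 makes
      -- 2 4 true, and a claw at 3 makes 3 4 true. The pentagon is 0 1 3 4 2.
      step₃ : R true (x 0F) (x 1F) → R true (x 0F) (x 2F) → R false (x 0F) (x 3F) → R false (x 0F) (x 4F) →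
              R false (x 1F) (x 2F) → R true (x 1F) (x 3F) → R false (x 1F) (x 4F) → Pentagon
      step₃ t₀₁ t₀₂ f₀₃ f₀₄ f₁₂ t₁₃ f₁₄ with colour 2F 3F | colour 2F 4F | colour 3F 4F
      ... | inj₁ t₂₃ | _ | inj₁ t₃₄ = ⊥-elim (no-claw true 3F 1F 2F 4F (R-sym t₁₃) (R-sym t₂₃) t₃₄)
      ... | inj₁ t₂₃ | _ | inj₂ f₃₄ = ⊥-elim (no-claw false 4F 0F 1F 3F (R-sym f₀₄) (R-sym f₁₄) (R-sym f₃₄))
      ... | inj₂ f₂₃ | inj₂ f₂₄ | _ = ⊥-elim (no-claw false 2F 1F 3F 4F (R-sym f₁₂) f₂₃ f₂₄)
      ... | inj₂ f₂₃ | inj₁ t₂₄ | inj₂ f₃₄ = ⊥-elim (no-claw false 3F 0F 2F 4F (R-sym f₀₃) (R-sym f₂₃) f₃₄)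
      ... | inj₂ f₂₃ | inj₁ t₂₄ | inj₁ t₃₄ = record
        { points = reorder points (0F ∷ 1F ∷ 3F ∷ 4F ∷ 2F ∷ []) _
        ; r₀₁ = t₀₁ ; r₁₂ = t₁₃ ; r₂₃ = t₃₄ ; r₃₄ = R-sym t₂₄ ; r₄₀ = R-sym t₀₂
        ; r₀₂ = f₀₃ ; r₂₄ = R-sym f₂₃ ; r₄₁ = R-sym f₁₂ ; r₁₃ = f₁₄ ; r₃₀ = R-sym f₀₄
        }

    -- If 1 2 were true, there would be a claw at 1, 2 or 3. So 1 2 is false, and claws at 1 leave
    -- exactly one of 1 3 and 1 4 true; exchanging 3 and 4 reduces the second possibility to the
    -- first.
    step₂ : (points : Points) (let x = proj₁ points) →
            R true (x 0F) (x 1F) → R true (x 0F) (x 2F) → R false (x 0F) (x 3F) → R false (x 0F) (x 4F) → Pentagon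
    step₂ points t₀₁ t₀₂ f₀₃ f₀₄ = by (colour 1F 2F) (colour 1F 3F) (colour 1F 4F) (colour 2F 3F)
      where
      open Steps points
      by : _ → _ → _ → _ → Pentagon
      by (inj₁ t₁₂) (inj₁ t₁₃) _          _          = ⊥-elim (no-claw true 1F 0F 2F 3F (R-sym t₀₁) t₁₂ t₁₃)
      by (inj₁ t₁₂) (inj₂ f₁₃) _          (inj₁ t₂₃) = ⊥-elim (no-claw true 2F 0F 1F 3F (R-sym t₀₂) (R-sym t₁₂) t₂₃)
      by (inj₁ t₁₂) (inj₂ f₁₃) _          (inj₂ f₂₃) = ⊥-elim (no-claw false 3F 0F 1F 2F (R-sym f₀₃) (R-sym f₁₃) (R-sym f₂₃))
      by (inj₂ f₁₂) (inj₁ t₁₃) (inj₁ t₁₄) _          = ⊥-elim (no-claw true 1F 0F 3F 4F (R-sym t₀₁) t₁₃ t₁₄)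
      by (inj₂ f₁₂) (inj₁ t₁₃) (inj₂ f₁₄) _          = step₃ t₀₁ t₀₂ f₀₃ f₀₄ f₁₂ t₁₃ f₁₄
      by (inj₂ f₁₂) (inj₂ f₁₃) (inj₂ f₁₄) _          = ⊥-elim (no-claw false 1F 2F 3F 4F f₁₂ f₁₃ f₁₄)
      by (inj₂ f₁₂) (inj₂ f₁₃) (inj₁ t₁₄) _          =
        Steps.step₃ (reorder points (0F ∷ 1F ∷ 2F ∷ 4F ∷ 3F ∷ []) _) t₀₁ t₀₂ f₀₄ f₀₃ f₁₂ t₁₄ f₁₃

  -- Without a claw at 0, two of its four pairs are true and two are false. The points are reordered
  -- so that the true ones come first.
  pentagon : Points → Pentagon
  pentagon points = by (colour 0F 1F) (colour 0F 2F) (colour 0F 3F) (colour 0F 4F)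
    where
    open Steps points
    by : _ → _ → _ → _ → Pentagon
    by (inj₁ p) (inj₁ q) (inj₁ r) _        = ⊥-elim (no-claw true 0F 1F 2F 3F p q r)
    by (inj₁ p) (inj₁ q) _        (inj₁ s) = ⊥-elim (no-claw true 0F 1F 2F 4F p q s)
    by (inj₁ p) _        (inj₁ r) (inj₁ s) = ⊥-elim (no-claw true 0F 1F 3F 4F p r s)
    by _        (inj₁ q) (inj₁ r) (inj₁ s) = ⊥-elim (no-claw true 0F 2F 3F 4F q r s)
    by (inj₂ p) (inj₂ q) (inj₂ r) _        = ⊥-elim (no-claw false 0F 1F 2F 3F p q r)
    by (inj₂ p) (inj₂ q) _        (inj₂ s) = ⊥-elim (no-claw false 0F 1F 2F 4F p q s)
    by (inj₂ p) _        (inj₂ r) (inj₂ s) = ⊥-elim (no-claw false 0F 1F 3F 4F p r s)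
    by _        (inj₂ q) (inj₂ r) (inj₂ s) = ⊥-elim (no-claw false 0F 2F 3F 4F q r s)
    by (inj₁ p) (inj₁ q) (inj₂ r) (inj₂ s) = step₂ points p q r s
    by (inj₁ p) (inj₂ q) (inj₁ r) (inj₂ s) = step₂ (reorder points (0F ∷ 1F ∷ 3F ∷ 2F ∷ 4F ∷ []) _) p r q s
    by (inj₁ p) (inj₂ q) (inj₂ r) (inj₁ s) = step₂ (reorder points (0F ∷ 1F ∷ 4F ∷ 2F ∷ 3F ∷ []) _) p s q r
    by (inj₂ p) (inj₁ q) (inj₁ r) (inj₂ s) = step₂ (reorder points (0F ∷ 2F ∷ 3F ∷ 1F ∷ 4F ∷ []) _) q r p s
    by (inj₂ p) (inj₁ q) (inj₂ r) (inj₁ s) = step₂ (reorder points (0F ∷ 2F ∷ 4F ∷ 1F ∷ 3F ∷ []) _) q s p r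
    by (inj₂ p) (inj₂ q) (inj₁ r) (inj₁ s) = step₂ (reorder points (0F ∷ 3F ∷ 4F ∷ 1F ∷ 2F ∷ []) _) r s p q

-- Recognising the Petersen graph

EndOf : Fin 10 → Fin 15 → Set
EndOf p k = proj₁ (petersenEnds k) ≡ p ⊎ proj₂ (petersenEnds k) ≡ p

-- Verified by evaluation over all pairs of edges. It allows edges of a copy to be identified by
-- their ends.
petersen-simple : ∀ j k → petersenEnds j ≡ petersenEnds k ⊎ petersenEnds j ≡ swap (petersenEnds k) → j ≡ k
petersen-simple = toWitness {a? = all? λ j → all? λ k →
  ((petersenEnds j ≟² petersenEnds k) ⊎-dec (petersenEnds j ≟² swap (petersenEnds k))) →-dec (j ≟ k)} _
  where
  _≟²_ : (p q : Fin 10 × Fin 10) → Dec (p ≡ q)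
  _≟²_ = ×.≡-dec _≟_ _≟_

-- Row `p` holds the indices of the three edges at the vertex `p`; `petersen-star` checks the table
-- by evaluation.
petersenStar : Vec (Fin 15 × Fin 15 × Fin 15) 10
petersenStar =
  (# 0 , # 4 , # 5)   ∷ (# 0 , # 1 , # 6)   ∷ (# 1 , # 2 , # 7)   ∷ (# 2 , # 3 , # 8)   ∷ (# 3 , # 4 , # 9)   ∷
  (# 5 , # 10 , # 14) ∷ (# 6 , # 12 , # 13) ∷ (# 7 , # 10 , # 11) ∷ (# 8 , # 13 , # 14) ∷ (# 9 , # 11 , # 12) ∷ []

petersen-star : ∀ p → let i , j , k = lookup petersenStar p in
                i ≢ j × i ≢ k × j ≢ k × EndOf p i × EndOf p j × EndOf p k
petersen-star = toWitness {a? = all? λ p → let i , j , k = lookup petersenStar p in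
  ¬? (i ≟ j) ×-dec ¬? (i ≟ k) ×-dec ¬? (j ≟ k) ×-dec endOf? p i ×-dec endOf? p j ×-dec endOf? p k} _
  where
  endOf? : ∀ p k → Dec (EndOf p k)
  endOf? p k = (proj₁ (petersenEnds k) ≟ p) ⊎-dec (proj₂ (petersenEnds k) ≟ p)

module PetersenCopy (G : Graph) (cubic : Cubic G) (S : EdgeSet G) (twoFactor : TwoFactor G S)
  (Φ : Fin 10 → Fin (n G)) (Φ-injective : ∀ {p q} → Φ p ≡ Φ q → p ≡ q)
  (Ψ : Fin 15 → Fin (m G))
  (Ψ-joins : ∀ k → EdgeSpace.Joins G (Ψ k) (Φ (proj₁ (petersenEnds k))) (Φ (proj₂ (petersenEnds k))))
  (connected-to : ∀ v → ∃[ p ] Reach G S (Φ p) v) where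
  open EdgeSpace G
  open CubicTwoFactor G cubic S twoFactor

  pair-injective : ∀ {p q p′ q′} → (Φ p , Φ q) ≡ (Φ p′ , Φ q′) → (p , q) ≡ (p′ , q′)
  pair-injective eq = cong₂ _,_ (Φ-injective (cong proj₁ eq)) (Φ-injective (cong proj₂ eq))

  same-ends : ∀ {e p q p′ q′} → Joins e (Φ p) (Φ q) → Joins e (Φ p′) (Φ q′) →
              (p , q) ≡ (p′ , q′) ⊎ (p , q) ≡ (q′ , p′)
  same-ends (inj₁ a) (inj₁ b) = inj₁ (pair-injective (trans (sym a) b))
  same-ends (inj₁ a) (inj₂ b) = inj₂ (pair-injective (trans (sym a) b))
  same-ends (inj₂ a) (inj₁ b) = inj₂ (pair-injective (cong swap (trans (sym a) b)))
  same-ends (inj₂ a) (inj₂ b) = inj₁ (pair-injective (cong swap (trans (sym a) b)))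

  Ψ-injective : ∀ j k → Ψ j ≡ Ψ k → j ≡ k
  Ψ-injective j k eq = petersen-simple j k (same-ends (Ψ-joins j)
    (subst (λ e → Joins e (Φ (proj₁ (petersenEnds k))) (Φ (proj₂ (petersenEnds k)))) (sym eq) (Ψ-joins k)))

  Ψ-incident : ∀ {p} k → EndOf p k → Incident G (Φ p) (Ψ k)
  Ψ-incident k (inj₁ refl) = joins-incidentˡ (Ψ-joins k)
  Ψ-incident k (inj₂ refl) = joins-incidentʳ (Ψ-joins k)

  -- The copy already has three distinct edges at `Φ p`, and `G` is cubic.
  Ψ-cover : ∀ p {e} → Incident G (Φ p) e → ∃[ k ] Ψ k ≡ e
  Ψ-cover p {e} p∈e =
    let i≢j , i≢k , j≢k , pi , pj , pk = petersen-star p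
    in by (three-cover (i≢j ∘ Ψ-injective _ _) (i≢k ∘ Ψ-injective _ _) (j≢k ∘ Ψ-injective _ _)
            (Ψ-incident _ pi) (Ψ-incident _ pj) (Ψ-incident _ pk) p∈e)
    where
    by : ∀ {i j k} → e ≡ Ψ i ⊎ e ≡ Ψ j ⊎ e ≡ Ψ k → ∃[ k ] Ψ k ≡ e
    by (inj₁ eq)        = _ , sym eq
    by (inj₂ (inj₁ eq)) = _ , sym eq
    by (inj₂ (inj₂ eq)) = _ , sym eq

  closed : ∀ {e v w} → S e ≡ true → Joins e v w → ∃[ p ] Φ p ≡ v → ∃[ p ] Φ p ≡ w
  closed {e} {w = w} _ eq (p , refl) = by (Ψ-cover p (joins-incidentˡ eq))
    where
    by : ∃[ k ] Ψ k ≡ e → ∃[ q ] Φ q ≡ w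
    by (k , refl) = [ (λ w≡ → proj₁ (petersenEnds k) , sym w≡) , (λ w≡ → proj₂ (petersenEnds k) , sym w≡) ]′
                      (joins-cover (Ψ-joins k) (joins-incidentʳ eq))

  abstract
    -- The image of `Φ` is closed under the edges of `S`, and every vertex is reached from it along
    -- `S`.
    Φ-surjective : ∀ v → ∃[ p ] Φ p ≡ v
    Φ-surjective v = let p , reach = connected-to v in
      reach-closed (λ w → ∃[ p ] Φ p ≡ w) closed reach (p , refl)

    Ψ-surjective : ∀ e → ∃[ k ] Ψ k ≡ e
    Ψ-surjective e = let p , eq = Φ-surjective (tl e) in Ψ-cover p (inj₁ eq)

  Φ⁻¹ : V → Fin 10
  Φ⁻¹ = proj₁ ∘ Φ-surjective

  Ψ⁻¹ : E → Fin 15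
  Ψ⁻¹ = proj₁ ∘ Ψ-surjective

  Φ⁻¹∘Φ : ∀ p → Φ⁻¹ (Φ p) ≡ p
  Φ⁻¹∘Φ p = Φ-injective (proj₂ (Φ-surjective (Φ p)))

  ends-match : ∀ {e p q} → Joins e (Φ p) (Φ q) →
               (p , q) ≡ (Φ⁻¹ (tl e) , Φ⁻¹ (hd e)) ⊎ (p , q) ≡ (Φ⁻¹ (hd e) , Φ⁻¹ (tl e))
  ends-match {p = p} {q} (inj₁ eq) = inj₁ (cong₂ _,_
    (sym (trans (cong (λ z → Φ⁻¹ (proj₁ z)) eq) (Φ⁻¹∘Φ p))) (sym (trans (cong (λ z → Φ⁻¹ (proj₂ z)) eq) (Φ⁻¹∘Φ q))))
  ends-match {p = p} {q} (inj₂ eq) = inj₂ (cong₂ _,_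
    (sym (trans (cong (λ z → Φ⁻¹ (proj₂ z)) eq) (Φ⁻¹∘Φ p))) (sym (trans (cong (λ z → Φ⁻¹ (proj₁ z)) eq) (Φ⁻¹∘Φ q))))

  Ψ⁻¹-joins : ∀ e → Joins e (Φ (proj₁ (petersenEnds (Ψ⁻¹ e)))) (Φ (proj₂ (petersenEnds (Ψ⁻¹ e))))
  Ψ⁻¹-joins e = subst (λ f → Joins f (Φ (proj₁ (petersenEnds (Ψ⁻¹ e)))) (Φ (proj₂ (petersenEnds (Ψ⁻¹ e)))))
                  (proj₂ (Ψ-surjective e)) (Ψ-joins (Ψ⁻¹ e))

  petersen : IsPetersen G
  petersen = mk↔ₛ′ Φ⁻¹ Φ Φ⁻¹∘Φ (λ v → proj₂ (Φ-surjective v))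
           , mk↔ₛ′ Ψ⁻¹ Ψ (λ k → Ψ-injective (Ψ⁻¹ (Ψ k)) k (proj₂ (Ψ-surjective (Ψ k)))) (λ e → proj₂ (Ψ-surjective e))
           , λ e → ends-match (Ψ⁻¹-joins e)

-- Links between crossing edges and the number of crossing edges

module Crossings (G : Graph) (cubic : Cubic G) (S : EdgeSet G) (twoFactor : TwoFactor G S)
                 (χ : Fin (n G) → Bool) (connected : ∀ u v → χ u ≡ χ v → Reach G S u v)
                 (monochromatic : ∀ e → S e ≡ true → χ (proj₁ (ends G e)) ≡ χ (proj₂ (ends G e)))
                 (odd : ⨁ χ ≡ true) (odd′ : ⨁ (λ v → not (χ v)) ≡ true) where
  open EdgeSpace G
  open CubicTwoFactor G cubic S twoFactor
  open Classes G cubic S twoFactor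
  open OddClasses χ connected monochromatic odd odd′
  open Side G cubic S twoFactor χ (λ u v p q → connected u v (trans p (sym q))) monochromatic odd
    using (crossing; crossing∉S)

  joins-same : ∀ {g v w} → S g ≡ true → Joins g v w → χ v ≡ χ w
  joins-same {g} s (inj₁ refl) = monochromatic g s
  joins-same {g} s (inj₂ refl) = sym (monochromatic g s)

  -- The index `c` tells which circuit carries the link; it becomes the colour of the pair in
  -- `TwoColouring`.
  Linked : Bool → E → E → Set
  Linked c e f = ∃[ g ] (S g ≡ true × ∃[ v ] ∃[ w ] (Joins g v w × Incident G v e × Incident G w f × χ v ≡ c))

  linked-sym : ∀ {c e f} → Linked c e f → Linked c f e
  linked-sym (g , s , v , w , eq , v∈e , w∈f , χv) =
    g , s , w , v , joins-sym eq , w∈f , v∈e , trans (sym (joins-same s eq)) χv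

  end-unique : ∀ {e v w} → crossing e ≡ true → Incident G v e → Incident G w e → χ v ≡ χ w → v ≡ w
  end-unique {v = v} {w} cross v∈e w∈e χ≡ = by (joins-cover joins v∈e) (joins-cover joins w∈e)
    where
    open CrossingEnds (crossing-ends cross)
    by : v ≡ u ⊎ v ≡ u′ → w ≡ u ⊎ w ≡ u′ → v ≡ w
    by (inj₁ refl) (inj₁ refl) = refl
    by (inj₁ refl) (inj₂ refl) = contradiction (trans (sym χu) (trans χ≡ χu′)) λ ()
    by (inj₂ refl) (inj₁ refl) = contradiction (trans (sym χu) (trans (sym χ≡) χu′)) λ ()
    by (inj₂ refl) (inj₂ refl) = refl

  spokes-disjoint : ∀ {e f v} → crossing e ≡ true → crossing f ≡ true → Incident G v e → Incident G v f → e ≡ f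
  spokes-disjoint {v = v} cross-e cross-f v∈e v∈f =
    trans (Star.spoke-unique (star v) (crossing∉S cross-e) v∈e)
          (sym (Star.spoke-unique (star v) (crossing∉S cross-f) v∈f))

  Crossing : Set
  Crossing = Σ E λ e → crossing e ≡ true

  -- Equations between Booleans have at most one proof.
  crossing-≡ : ∀ {e f : Crossing} → proj₁ e ≡ proj₁ f → e ≡ f
  crossing-≡ {e , p} {.e , q} refl = cong (e ,_) (Decidable⇒UIP.≡-irrelevant Boolₚ._≟_ p q)

  same-far-end : ∀ {g h v w z} {e f : Crossing} → Joins g v w → Joins h v z → g ≡ h →
                 Incident G w (proj₁ e) → Incident G z (proj₁ f) → e ≡ f
  same-far-end {e = e , cross-e} {f , cross-f} g-joins h-joins refl w∈e z∈f
    with joins-cover g-joins (joins-incidentʳ h-joins)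
  ... | inj₁ z≡v  = contradiction (sym z≡v) (joins-≢ h-joins)
  ... | inj₂ refl = crossing-≡ (spokes-disjoint cross-e cross-f w∈e z∈f)

  -- All three links start at the one end of `e` in the class `c`. Only two edges of `S` leave it,
  -- so two links use the same edge, and its far end lies on only one crossing edge.
  claw-free : ∀ c {e f₁ f₂ f₃ : Crossing} → f₁ ≢ f₂ → f₁ ≢ f₃ → f₂ ≢ f₃ →
              Linked c (proj₁ e) (proj₁ f₁) → Linked c (proj₁ e) (proj₁ f₂) → Linked c (proj₁ e) (proj₁ f₃) → ⊥
  claw-free c {e , cross-e} f₁≢f₂ f₁≢f₃ f₂≢f₃
    (g₁ , s₁ , v₁ , w₁ , j₁ , v₁∈e , w₁∈f₁ , χv₁)
    (g₂ , s₂ , v₂ , w₂ , j₂ , v₂∈e , w₂∈f₂ , χv₂)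
    (g₃ , s₃ , v₃ , w₃ , j₃ , v₃∈e , w₃∈f₃ , χv₃)
    with refl ← end-unique cross-e v₁∈e v₂∈e (trans χv₁ (sym χv₂))
    with refl ← end-unique cross-e v₁∈e v₃∈e (trans χv₁ (sym χv₃))
    with Star.S-edge (star v₁) s₁ (joins-incidentˡ j₁)
       | Star.S-edge (star v₁) s₂ (joins-incidentˡ j₂)
       | Star.S-edge (star v₁) s₃ (joins-incidentˡ j₃)
  ... | inj₁ p | inj₁ q | _      = f₁≢f₂ (same-far-end j₁ j₂ (trans p (sym q)) w₁∈f₁ w₂∈f₂)
  ... | inj₂ p | inj₂ q | _      = f₁≢f₂ (same-far-end j₁ j₂ (trans p (sym q)) w₁∈f₁ w₂∈f₂)
  ... | inj₁ p | inj₂ _ | inj₁ r = f₁≢f₃ (same-far-end j₁ j₃ (trans p (sym r)) w₁∈f₁ w₃∈f₃)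
  ... | inj₂ p | inj₁ _ | inj₂ r = f₁≢f₃ (same-far-end j₁ j₃ (trans p (sym r)) w₁∈f₁ w₃∈f₃)
  ... | inj₁ _ | inj₂ q | inj₂ r = f₂≢f₃ (same-far-end j₂ j₃ (trans q (sym r)) w₂∈f₂ w₃∈f₃)
  ... | inj₂ _ | inj₁ q | inj₁ r = f₂≢f₃ (same-far-end j₂ j₃ (trans q (sym r)) w₂∈f₂ w₃∈f₃)

  module FiveCrossings (total : ∀ {e f : Crossing} → e ≢ f →
                          Linked true (proj₁ e) (proj₁ f) ⊎ Linked false (proj₁ e) (proj₁ f)) where

    module T = TwoColouring {Crossing} (λ c e f → Linked c (proj₁ e) (proj₁ f)) linked-sym total claw-free

    module _ (P : T.Pentagon) where
      open T.Pentagon P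

      module X (i : Fin 5) = CrossingEnds (crossing-ends (proj₂ (x i)))

      vertex : Fin 5 ⊎ Fin 5 → V
      vertex = [ X.u , X.u′ ]′

      -- The outer vertices are the ends with colour true and the inner ones those with colour
      -- false, in the same order, so the crossing edges become the spokes of the Petersen graph.
      Φ : Fin 10 → V
      Φ p = vertex (splitAt 5 p)

      vertex-injective : ∀ a b → vertex a ≡ vertex b → a ≡ b
      vertex-injective (inj₁ i) (inj₁ j) eq = cong inj₁ (proj₂ points i j (crossing-≡
        (trans (sym (X.spoke-u i)) (trans (cong spoke eq) (X.spoke-u j)))))
      vertex-injective (inj₂ i) (inj₂ j) eq = cong inj₂ (proj₂ points i j (crossing-≡
        (trans (sym (X.spoke-u′ i)) (trans (cong spoke eq) (X.spoke-u′ j)))))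
      vertex-injective (inj₁ i) (inj₂ j) eq =
        contradiction (trans (sym (X.χu i)) (trans (cong χ eq) (X.χu′ j))) λ ()
      vertex-injective (inj₂ i) (inj₁ j) eq =
        contradiction (trans (sym (X.χu j)) (trans (cong χ (sym eq)) (X.χu′ i))) λ ()

      Φ-injective : ∀ {p q} → Φ p ≡ Φ q → p ≡ q
      Φ-injective {p} {q} eq = trans (sym (join-splitAt 5 5 p)) (trans
        (cong (Fin.join 5 5) (vertex-injective (splitAt 5 p) (splitAt 5 q) eq)) (join-splitAt 5 5 q))

      Edge : V × V → Set
      Edge (v , w) = ∃[ g ] Joins g v w

      outer : ∀ {i j} → Linked true (proj₁ (x i)) (proj₁ (x j)) → Edge (X.u i , X.u j)
      outer {i} {j} (g , s , v , w , eq , v∈ , w∈ , χv)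
        with refl ← end-unique (proj₂ (x i)) v∈ (joins-incidentˡ (X.joins i)) (trans χv (sym (X.χu i)))
        with refl ← end-unique (proj₂ (x j)) w∈ (joins-incidentˡ (X.joins j))
                      (trans (sym (joins-same s eq)) (trans χv (sym (X.χu j))))
        = g , eq

      inner : ∀ {i j} → Linked false (proj₁ (x i)) (proj₁ (x j)) → Edge (X.u′ i , X.u′ j)
      inner {i} {j} (g , s , v , w , eq , v∈ , w∈ , χv)
        with refl ← end-unique (proj₂ (x i)) v∈ (joins-incidentʳ (X.joins i)) (trans χv (sym (X.χu′ i)))
        with refl ← end-unique (proj₂ (x j)) w∈ (joins-incidentʳ (X.joins j))
                      (trans (sym (joins-same s eq)) (trans χv (sym (X.χu′ j))))
        = g , eq

      rung : ∀ i → Edge (X.u i , X.u′ i)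
      rung i = proj₁ (x i) , X.joins i

      edges : VecAll.All (λ (p , q) → Edge (Φ p , Φ q)) petersenEndsV
      -- As in `petersenEndsV`, the pentagon comes first, then the spokes, then the pentagram.
      edges = outer r₀₁ ∷ outer r₁₂ ∷ outer r₂₃ ∷ outer r₃₄ ∷ outer r₄₀ ∷
              rung 0F ∷ rung 1F ∷ rung 2F ∷ rung 3F ∷ rung 4F ∷
              inner r₀₂ ∷ inner r₂₄ ∷ inner r₄₁ ∷ inner r₁₃ ∷ inner r₃₀ ∷ []

      connected-to : ∀ v → ∃[ p ] Reach G S (Φ p) v
      connected-to v with χ v in χv
      ... | true  = # 0 , connected (Φ (# 0)) v (trans (X.χu 0F) (sym χv))
      ... | false = # 5 , connected (Φ (# 5)) v (trans (X.χu′ 0F) (sym χv))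

      petersen : IsPetersen G
      petersen = PetersenCopy.petersen G cubic S twoFactor Φ Φ-injective
        (λ k → proj₁ (lookup⁺ edges k)) (λ k → proj₂ (lookup⁺ edges k)) connected-to

    petersen-if-five : T.Points → IsPetersen G
    petersen-if-five points = petersen (T.pentagon points)

  -- A form of being linked, on either circuit, that quantifies over edges only and is therefore
  -- decided by one search.
  Meet : E → E → Set
  Meet e f = ∃[ g ] (S g ≡ true × ((Incident G (tl g) e × Incident G (hd g) f) ⊎
                                   (Incident G (hd g) e × Incident G (tl g) f)))

  meet? : ∀ e f → Dec (Meet e f)
  meet? e f = any? λ g → (S g Boolₚ.≟ true) ×-dec
    ((incident? (tl g) e ×-dec incident? (hd g) f) ⊎-dec (incident? (hd g) e ×-dec incident? (tl g) f))

  -- Each vertex of the odd class has one edge of `F₀`; edges inside the class use two of its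
  -- vertices, so an odd number of edges leave it.
  crossings-odd : ⨁ crossing ≡ true
  crossings-odd = begin
    ⨁ crossing                    ≡⟨ sum-cong-≗ on-F₀ ⟨
    ⨁ (λ e → F₀ e ∧ crossing e)   ≡⟨ handshake χ F₀ ⟨
    ⨁ (λ v → χ v ∧ ∂ F₀ v)        ≡⟨ sum-cong-≗ (λ v → trans (cong (χ v ∧_) (∂F₀ v)) (Boolₚ.∧-identityʳ (χ v))) ⟩
    ⨁ χ                           ≡⟨ odd ⟩
    true                          ∎
    where
    open ≡-Reasoning
    on-F₀ : ∀ e → F₀ e ∧ crossing e ≡ crossing e
    on-F₀ e = by (S e) refl
      where
      by : ∀ b → S e ≡ b → not b ∧ crossing e ≡ crossing e
      by false _ = refl
      by true  s = sym (trans (cong (_xor χ (hd e)) (monochromatic e s)) (Boolₚ.xor-same (χ (hd e))))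

  -- An even set of crossing edges cannot exhaust the odd set of all of them.
  another : ∀ K → (∀ e → K e ≡ true → crossing e ≡ true) → ⨁ K ≡ false →
            ∃[ e ] (crossing e ≡ true × K e ≡ false)
  another K K⊆ even =
    let e , eq = ⨁-true⇒∃ (crossing △ K) (trans (∑-distrib-+ crossing K) (cong₂ _xor_ crossings-odd even))
    in e , by (crossing e) (K e) (K⊆ e) eq
    where
    by : ∀ c k → (k ≡ true → c ≡ true) → c xor k ≡ true → c ≡ true × k ≡ false
    by true  false _   _ = refl , refl
    by false true  imp _ = contradiction (imp refl) λ ()

  module _ (bridgeless : Bridgeless G) (notPetersen : ¬ IsPetersen G) where

    -- A single crossing edge would be a bridge: a walk avoiding it could never change its class.
    second-crossing : ∀ {e₁} → crossing e₁ ≡ true → ∃[ e ] (crossing e ≡ true × e ≢ e₁)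
    second-crossing {e₁} cross₁ with any? (λ e → (crossing e Boolₚ.≟ true) ×-dec ¬? (e ≟ e₁))
    ... | yes found = found
    ... | no none = contradiction
      (trans (sym cross₁) (trans (cong (_xor χ (hd e₁)) (sym stays)) (Boolₚ.xor-same (χ (hd e₁))))) λ ()
      where
      uncrossed : ∀ {e v w} → without G e₁ e ≡ true → Joins e v w → χ v ≡ χ w
      uncrossed {e} e≠ eq = by eq (xor-false⇒≡ (Boolₚ.¬-not λ cross → none (e , cross , λ e≡e₁ →
        contradiction (trans (sym e≠) (cong not (dec-true (e₁ ≟ e) (sym e≡e₁)))) λ ())))
        where
        by : ∀ {v w} → Joins e v w → χ (tl e) ≡ χ (hd e) → χ v ≡ χ w
        by (inj₁ refl) = id
        by (inj₂ refl) = sym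

      stays : χ (hd e₁) ≡ χ (tl e₁)
      stays = reach-closed (λ v → χ v ≡ χ (tl e₁))
        (λ e≠ eq χv → trans (sym (uncrossed e≠ eq)) χv) (bridgeless e₁) refl

    pair : E → E → EdgeSet G
    pair e f = ⁅ e ⁆ △ ⁅ f ⁆

    pair-even : ∀ e f → ⨁ (pair e f) ≡ false
    pair-even e f = trans (∑-distrib-+ ⁅ e ⁆ ⁅ f ⁆) (cong₂ _xor_ (⨁-single e) (⨁-single f))

    pair-crossing : ∀ {e f} → crossing e ≡ true → crossing f ≡ true → ∀ g → pair e f g ≡ true → crossing g ≡ true
    pair-crossing {e} {f} cross-e cross-f g eq with xor-cases (⁅ e ⁆ g) eq
    ... | inj₁ g∈ = subst (λ z → crossing z ≡ true) (sym (⁅⁆-true g∈)) cross-e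
    ... | inj₂ g∈ = subst (λ z → crossing z ≡ true) (sym (⁅⁆-true g∈)) cross-f

    pair-first : ∀ {e f} → e ≢ f → pair e f e ≡ true
    pair-first {e} e≢f = cong₂ _xor_ (⁅⁆-self e) (⁅⁆-other e≢f)

    pair-second : ∀ {e f} → e ≢ f → pair e f f ≡ true
    pair-second {f = f} e≢f = cong₂ _xor_ (⁅⁆-other (e≢f ∘ sym)) (⁅⁆-self f)

    pair-other : ∀ {e f g} → g ≢ e → g ≢ f → pair e f g ≡ false
    pair-other g≢e g≢f = cong₂ _xor_ (⁅⁆-other g≢e) (⁅⁆-other g≢f)

    ∉-≢ : ∀ {K : EdgeSet G} {e f} → K e ≡ false → K f ≡ true → e ≢ f
    ∉-≢ ¬Ke Kf refl = contradiction (trans (sym Kf) ¬Ke) λ ()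

    five-distinct : ∀ (e₁ e₂ e₃ e₄ e₅ : Crossing) → let ≠ = λ (e f : Crossing) → proj₁ e ≢ proj₁ f in
      ≠ e₂ e₁ → ≠ e₃ e₁ → ≠ e₃ e₂ → ≠ e₄ e₁ → ≠ e₄ e₂ → ≠ e₄ e₃ → ≠ e₅ e₁ → ≠ e₅ e₂ → ≠ e₅ e₃ → ≠ e₅ e₄ →
      Σ (Fin 5 → Crossing) λ x → ∀ i j → x i ≡ x j → i ≡ j
    five-distinct e₁ e₂ e₃ e₄ e₅ ≠₂₁ ≠₃₁ ≠₃₂ ≠₄₁ ≠₄₂ ≠₄₃ ≠₅₁ ≠₅₂ ≠₅₃ ≠₅₄ =
      lookup (e₁ ∷ e₂ ∷ e₃ ∷ e₄ ∷ e₅ ∷ []) , lookup-injective unique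
      where
      flip : ∀ {e f : Crossing} → proj₁ f ≢ proj₁ e → e ≢ f
      flip ≠ refl = ≠ refl
      unique : Unique (e₁ ∷ e₂ ∷ e₃ ∷ e₄ ∷ e₅ ∷ [])
      unique = (flip ≠₂₁ ∷ flip ≠₃₁ ∷ flip ≠₄₁ ∷ flip ≠₅₁ ∷ [])
             ∷ (flip ≠₃₂ ∷ flip ≠₄₂ ∷ flip ≠₅₂ ∷ [])
             ∷ (flip ≠₄₃ ∷ flip ≠₅₃ ∷ [])
             ∷ (flip ≠₅₄ ∷ [])
             ∷ [] ∷ []

    Fourth : E → E → E → Set
    Fourth e₁ e₂ e₃ = ∃[ e ] (crossing e ≡ true × e ≢ e₁ × e ≢ e₂ × e ≢ e₃)

    fourth? : ∀ e₁ e₂ e₃ → Dec (Fourth e₁ e₂ e₃)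
    fourth? e₁ e₂ e₃ = any? λ e → (crossing e Boolₚ.≟ true) ×-dec ¬? (e ≟ e₁) ×-dec ¬? (e ≟ e₂) ×-dec ¬? (e ≟ e₃)

    no-fourth : ∀ {e₁ e₂ e₃} → ¬ Fourth e₁ e₂ e₃ → ∀ {e} → crossing e ≡ true → e ≡ e₁ ⊎ e ≡ e₂ ⊎ e ≡ e₃
    no-fourth {e₁} {e₂} {e₃} none {e} cross = by (e ≟ e₁) (e ≟ e₂) (e ≟ e₃)
      where
      by : Dec (e ≡ e₁) → Dec (e ≡ e₂) → Dec (e ≡ e₃) → e ≡ e₁ ⊎ e ≡ e₂ ⊎ e ≡ e₃
      by (yes eq) _        _        = inj₁ eq
      by (no _)   (yes eq) _        = inj₂ (inj₁ eq)
      by (no _)   (no _)   (yes eq) = inj₂ (inj₂ eq)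
      by (no p)   (no q)   (no r)   = contradiction (e , cross , p , q , r) none

    -- Four crossing edges form an even set, so parity supplies a fifth.
    five-crossings : ∀ {e₁ e₂ e₃} → crossing e₁ ≡ true → crossing e₂ ≡ true → e₂ ≢ e₁ →
                     crossing e₃ ≡ true → pair e₁ e₂ e₃ ≡ false → Fourth e₁ e₂ e₃ →
                     Σ (Fin 5 → Crossing) λ x → ∀ i j → x i ≡ x j → i ≡ j
    five-crossings {e₁} {e₂} {e₃} c₁ c₂ ≠₂₁ c₃ e₃∉ (e₄ , c₄ , ≠₄₁ , ≠₄₂ , ≠₄₃) = points
      where
      ≠₃₁ : e₃ ≢ e₁
      ≠₃₁ = ∉-≢ {pair e₁ e₂} e₃∉ (pair-first (≠₂₁ ∘ sym))
      ≠₃₂ : e₃ ≢ e₂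
      ≠₃₂ = ∉-≢ {pair e₁ e₂} e₃∉ (pair-second (≠₂₁ ∘ sym))

      K : EdgeSet G
      K = pair e₁ e₂ △ pair e₃ e₄

      K-crossing : ∀ e → K e ≡ true → crossing e ≡ true
      K-crossing e Ke with xor-cases (pair e₁ e₂ e) Ke
      ... | inj₁ eq = pair-crossing c₁ c₂ e eq
      ... | inj₂ eq = pair-crossing c₃ c₄ e eq

      fifth : ∃[ e ] (crossing e ≡ true × K e ≡ false)
      fifth = another K K-crossing
        (trans (∑-distrib-+ (pair e₁ e₂) (pair e₃ e₄)) (cong₂ _xor_ (pair-even e₁ e₂) (pair-even e₃ e₄)))

      e₅ : E
      e₅ = proj₁ fifth

      avoids : ∀ {e} → K e ≡ true → e₅ ≢ e
      avoids = ∉-≢ {K} (proj₂ (proj₂ fifth))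

      points : Σ (Fin 5 → Crossing) λ x → ∀ i j → x i ≡ x j → i ≡ j
      points = five-distinct (e₁ , c₁) (e₂ , c₂) (e₃ , c₃) (e₄ , c₄) (e₅ , proj₁ (proj₂ fifth))
        ≠₂₁ ≠₃₁ ≠₃₂ ≠₄₁ ≠₄₂ ≠₄₃
        (avoids (cong₂ _xor_ (pair-first (≠₂₁ ∘ sym)) (pair-other (≠₃₁ ∘ sym) (≠₄₁ ∘ sym))))
        (avoids (cong₂ _xor_ (pair-second (≠₂₁ ∘ sym)) (pair-other (≠₃₂ ∘ sym) (≠₄₂ ∘ sym))))
        (avoids (cong₂ _xor_ (pair-other ≠₃₁ ≠₃₂) (pair-first (≠₄₃ ∘ sym))))
        (avoids (cong₂ _xor_ (pair-other ≠₄₁ ≠₄₂) (pair-second (≠₄₃ ∘ sym))))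

    Total : Set
    Total = ∀ {e f : Crossing} → e ≢ f → Linked true (proj₁ e) (proj₁ f) ⊎ Linked false (proj₁ e) (proj₁ f)

    -- Parity supplies the first crossing edge, bridgelessness the second and parity the third. A
    -- fourth would bring a fifth and turn `G` into the Petersen graph, so there are exactly three.
    solution-linked : Total → Solution
    solution-linked total =
      let e₁ , c₁ , _   = another ∅ (λ _ ()) (⨁-false {f = ∅} (λ _ → refl))
          e₂ , c₂ , ≠₂₁ = second-crossing c₁
          e₃ , c₃ , e₃∉ = another (pair e₁ e₂) (pair-crossing c₁ c₂) (pair-even e₁ e₂)
      in by c₁ c₂ ≠₂₁ c₃ e₃∉ (fourth? e₁ e₂ e₃)
      where
      by : ∀ {e₁ e₂ e₃} → crossing e₁ ≡ true → crossing e₂ ≡ true → e₂ ≢ e₁ →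
           crossing e₃ ≡ true → pair e₁ e₂ e₃ ≡ false → Dec (Fourth e₁ e₂ e₃) → Solution
      by {e₃ = e₃} c₁ c₂ ≠₂₁ c₃ e₃∉ (no none) = solution-three {e₃ = e₃} c₁ c₂ ≠₂₁ (no-fourth none)
      by c₁ c₂ ≠₂₁ c₃ e₃∉ (yes fourth) =
        contradiction (FiveCrossings.petersen-if-five total (five-crossings c₁ c₂ ≠₂₁ c₃ e₃∉ fourth)) notPetersen

    Unlinked : Set
    Unlinked = ∃[ e ] ∃[ f ] (crossing e ≡ true × crossing f ≡ true × e ≢ f × ¬ Meet e f)

    unlinked? : Dec Unlinked
    unlinked? = any? λ e → any? λ f →
      (crossing e Boolₚ.≟ true) ×-dec (crossing f Boolₚ.≟ true) ×-dec ¬? (e ≟ f) ×-dec ¬? (meet? e f)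

    linked-total : ¬ Unlinked → Total
    linked-total all-linked {e , cross-e} {f , cross-f} e≢f = by (decidable-stable (meet? e f) λ unlinked →
        all-linked (e , f , cross-e , cross-f , (λ eq → e≢f (crossing-≡ eq)) , unlinked))
      where
      coloured : ∀ c {g v w} → χ v ≡ c → S g ≡ true → Joins g v w → Incident G v e → Incident G w f →
                 Linked true e f ⊎ Linked false e f
      coloured true  χv s eq v∈e w∈f = inj₁ (_ , s , _ , _ , eq , v∈e , w∈f , χv)
      coloured false χv s eq v∈e w∈f = inj₂ (_ , s , _ , _ , eq , v∈e , w∈f , χv)
      by : Meet e f → Linked true e f ⊎ Linked false e f
      by (g , s , inj₁ (t∈e , h∈f)) = coloured (χ (tl g)) refl s (joins-ends g) t∈e h∈f
      by (g , s , inj₂ (h∈e , t∈f)) = coloured (χ (hd g)) refl s (joins-sym (joins-ends g)) h∈e t∈f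

    solution-odd : Solution
    solution-odd = by unlinked?
      where
      meet : ∀ {e f g v w} → S g ≡ true → Joins g v w → Incident G v e → Incident G w f → Meet e f
      meet s (inj₁ refl) v∈e w∈f = _ , s , inj₁ (v∈e , w∈f)
      meet s (inj₂ refl) v∈e w∈f = _ , s , inj₂ (v∈e , w∈f)
      by : Dec Unlinked → Solution
      by (yes (e , f , cross-e , cross-f , e≢f , unlinked)) =
        solution-unlinked cross-e cross-f e≢f λ s eq v∈e w∈f → unlinked (meet s eq v∈e w∈f)
      by (no all-linked) = solution-linked (linked-total all-linked)

-- Case distinction on the two classes

module TwoClasses (G : Graph) (cubic : Cubic G) (bridgeless : Bridgeless G) (S : EdgeSet G)
                  (twoFactor : TwoFactor G S) (notPetersen : ¬ IsPetersen G)
                  (χ : Fin (n G) → Bool) (connected : ∀ u v → χ u ≡ χ v → Reach G S u v) where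
  open EdgeSpace G
  open Classes G cubic S twoFactor

  Bichromatic : Set
  Bichromatic = ∃[ e ] (S e ≡ true × χ (tl e) ≢ χ (hd e))

  bichromatic? : Dec Bichromatic
  bichromatic? = any? λ e → (S e Boolₚ.≟ true) ×-dec ¬? (χ (tl e) Boolₚ.≟ χ (hd e))

  -- An edge of `S` between the two connected classes joins them into one component, so `S` is a
  -- Hamiltonian circuit.
  bichromatic-connected : Bichromatic → ∀ u v → Reach G S u v
  bichromatic-connected (e , s , χ≢) u v = reach-trans (reach-sym (from-tl u)) (from-tl v)
    where
    other : ∀ {p q r} → p ≢ q → r ≢ p → q ≡ r
    other {p} {q} {r} p≢q r≢p = trans (Boolₚ.¬-not (p≢q ∘ sym)) (sym (Boolₚ.¬-not r≢p))
    by : ∀ v → Dec (χ v ≡ χ (tl e)) → Reach G S (tl e) v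
    by v (yes eq) = connected (tl e) v (sym eq)
    by v (no ≢)   = reach-trans (reach-edge s (joins-ends e)) (connected (hd e) v (other χ≢ ≢))
    from-tl : ∀ v → Reach G S (tl e) v
    from-tl v = by v (χ v Boolₚ.≟ χ (tl e))

  -- The two classes together contain all vertices, an even number since `F₀` is odd at each of
  -- them.
  classes-even : ⨁ χ xor ⨁ (λ v → not (χ v)) ≡ false
  classes-even = begin
    ⨁ χ xor ⨁ (λ v → not (χ v))  ≡⟨ ∑-distrib-+ χ (λ v → not (χ v)) ⟨
    ⨁ (λ v → χ v xor not (χ v))  ≡⟨ sum-cong-≗ (λ v → trans (Boolₚ.xor-inverseʳ (χ v)) (sym (∂F₀ v))) ⟩
    ⨁ (∂ F₀)                     ≡⟨ handshake-total F₀ ⟩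
    false                        ∎
    where open ≡-Reasoning

  two-classes : Solution
  two-classes = by bichromatic?
    where
    -- By `classes-even` the two parities agree, so only two of the four combinations occur.
    by-parity : (∀ e → S e ≡ true → χ (tl e) ≡ χ (hd e)) →
                ∀ p q → ⨁ χ ≡ p → ⨁ (λ v → not (χ v)) ≡ q → p xor q ≡ false → Solution
    by-parity mono true  true  odd  odd′  _ =
      Crossings.solution-odd G cubic S twoFactor χ connected mono odd odd′ bridgeless notPetersen
    by-parity mono false false even even′ _ = solution-even χ connected even even′

    by : Dec Bichromatic → Solution
    by (yes bichromatic) = solution-connected (bichromatic-connected bichromatic)
    by (no none) = by-parity
      (λ e s → decidable-stable (χ (tl e) Boolₚ.≟ χ (hd e)) λ χ≢ → none (e , s , χ≢))
      (⨁ χ) (⨁ (λ v → not (χ v))) refl refl classes-even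

theorem4 : (G : Graph) → Cubic G → Bridgeless G →
    (∃[ S ] (TwoFactor G S × AtMostTwoCycles G S)) →
    ¬ IsPetersen G →
    ∃[ F ] (PerfectMatching G F ×
      Σ ℕ λ k → Σ (Fin (n G) → Fin k) λ c → CycleLabelling G F k c ×
        ∃[ θ ] (NZFlowContraction G F c θ × NonConflicting G F θ))
theorem4 G cubic bridgeless (S , twoFactor , c , same-class) notPetersen =
  TwoClasses.two-classes G cubic bridgeless S twoFactor notPetersen (λ v → does (c v ≟ 0F))
    (λ u v eq → same-class u v (class-determined (c u) (c v) eq))
  where
  -- There are only two labels, so the Boolean colour loses no information.
  class-determined : ∀ (i j : Fin 2) → does (i ≟ 0F) ≡ does (j ≟ 0F) → i ≡ j
  class-determined 0F 0F _ = refl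
  class-determined 1F 1F _ = refl
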